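{- Let $[\widehat{0},\widehat{1}]$ be a graded Eulerian poset of rank $n+1$. Then $$ \operatorname{t}([\widehat{0},\widehat{1}),x)=\sum_w [w]\,\Phi_{[\widehat{0},\widehat{1}]}(c,d)\cdot \operatorname{t}(w,x), $$ where the summation runs over all $cd$-words $w$ of degree $n$, and $[w]\,\Phi$ denotes the coefficient of $w$ in $\Phi$. Here $\operatorname{t}(w,x)$ is the total weight of all $\lambda=(\lambda_1,\dots,\lambda_n)\in\{ -1,1\}^n$ such that the set of positions covered by letters $d$ in $w$ equals $R(\lambda)\cup(R(\lambda)-1)$ and $\lambda_1+\cdots+\lambda_i\geq 0$ holds for all $i\in[1,n]$. The weight of each such $\lambda$ is the product of the following factors: (1) each $\lambda_i=-1$ contributes a factor of $-1/x$; (2) each $\lambda_i=1$ contributes a factor of $x$; (3) each element of $R(\lambda)$ contributes an additional factor of $-1$.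
   Context: A graded poset is a finite poset with a unique minimum $\widehat{0}$, a unique maximum $\widehat{1}$ and a rank function $\rho:P\to\mathbb{N}$ with $\rho(\widehat{0})=0$ and $\rho(y)=\rho(x)+1$ whenever $y$ covers $x$; its rank is $\rho(\widehat{1})$. It is Eulerian if $\sum_{z\in[u,v]}(-1)^{\rho(z)}=0$ for all $u<v$. Write $[\widehat{0},p)=\{q: q<p\}$ and $[1,n]=\{1,\dots,n\}$. For $\lambda\in\{ -1,1\}^n$, $R(\lambda)=\{i\in[1,n]:\lambda_1+\cdots+\lambda_i=0\}$ and $R(\lambda)-1=\{i-1:i\in R(\lambda)\}$. $cd$-words: words in the letters $c$ (degree $1$) and $d$ (degree $2$). In a $cd$-word of degree $n$, reading from left to right, each $c$ covers one position and each $d$ covers two consecutive positions of $[1,n]$. $cd$-index: for a graded poset $P$ of rank $n+1$ and $S\subseteq[1,n]$, let $f_S$ be the number of maximal chains of $P_S=\{u\in P:\rho(u)\in S\}$, and $h_S=\sum_{T\subseteq S}(-1)^{|S|-|T|}f_T$. The $ab$-index is $\sum_{S\subseteq[1,n]}h_Su_S$, where $u_S=u_1\cdots u_n$ is the word in noncommuting letters with $u_i=b$ if $i\in S$ and $u_i=a$ if $i\notin S$. If $P$ is Eulerian, the $ab$-index is (uniquely) a polynomial $\Phi_P(c,d)$ in the noncommuting variables $c=a+b$ and $d=ab+ba$, called the $cd$-index. Stanley's toric polynomials: $f(\emptyset,x)=g(\emptyset,x)=1$ ($\emptyset$ being $[\widehat{0},\widehat{1})$ for the Eulerian poset of rank $0$),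 and for an Eulerian poset of rank at least $1$, $$f([\widehat{0},\widehat{1}),x)=\sum_{p\in[\widehat{0},\widehat{1})} g([\widehat{0},p),x)(x-1)^{\rho(\widehat{1})-1-\rho(p)},$$ $$g([\widehat{0},\widehat{1}),x)=\sum_{i=0}^{\lfloor(\rho(\widehat{1})-1)/2\rfloor}\left([x^i]f([\widehat{0},\widehat{1}),x)-[x^{i-1}]f([\widehat{0},\widehat{1}),x)\right)x^i.$$ By a theorem of Stanley, if the rank is $n+1$ then $f([\widehat{0},\widehat{1}),x)$ has degree $n$ and satisfies $x^nf([\widehat{0},\widehat{1}),1/x)=f([\widehat{0},\widehat{1}),x)$. Short toric polynomial: for an Eulerian poset of rank $n+1$, $\operatorname{t}([\widehat{0},\widehat{1}),x)$ is the unique polynomial $q(x)$ of degree $n$ with $q(x)=(-1)^nq(-x)$ and $f([\widehat{0},\widehat{1}),x)=x^{n/2}\left(q(\sqrt{x})+q(1/\sqrt{x})-q(0)\right)$; equivalently, it is obtained from $x^{n}f([\widehat{0},\widehat{1}),x^{ -2})$ by discarding all terms of negative degree. -}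

module Defs where

open import Algebra.Bundles using (Monoid)
open import Data.Bool.Base using (Bool; true; false; if_then_else_)
open import Data.Fin.Base using (Fin; toℕ)
open import Data.Fin.Induction using (po-wellFounded)
open import Data.Fin.Properties using (all?; any?)
open import Data.Fin.Subset using (Subset; _∈_; _⊆_; _⊂_; ∣_∣)
open import Data.Fin.Subset.Properties using (_∈?_; _⊆?_; _⊂?_; anySubset?)
open import Data.Integer.Base as ℤ using (ℤ; +_; 0ℤ; 1ℤ; -1ℤ)
import Data.Integer.Properties as ℤ
open import Data.List.Base as List using (List; []; _∷_; _++_; length; filter; allFin; upTo; cartesianProductWith; concatMap)
import Data.List.Membership.DecPropositional as DecMembership
open import Data.List.Properties using (++-monoid; ≡-dec)
open import Data.List.Relation.Unary.All as All using (All)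
open import Data.Nat.Base as ℕ using (ℕ; zero; suc; ⌊_/2⌋)
import Data.Nat.Properties as ℕ
open import Data.Product.Base using (_×_; _,_; ∃; map₁; map₂)
open import Data.Sign.Base as Sign using (Sign)
open import Data.Sum.Base using (_⊎_)
open import Data.Vec.Base as Vec using (Vec; []; _∷_)
open import Induction.WellFounded using (Acc; acc; WellFounded)
open import Level using (0ℓ)
open import Relation.Binary.Core using (Rel)
open import Relation.Binary.Definitions using (Decidable; DecidableEquality; Minimum; Maximum)
import Relation.Binary.Construct.NonStrictToStrict as ToStrict
open import Relation.Binary.PropositionalEquality.Core using (_≡_; refl)
open import Relation.Binary.Structures using (IsDecPartialOrder)
open import Relation.Nullary.Decidable using (Dec; yes; no; does; ¬?; _×-dec_; _⊎-dec_; _→-dec_)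
open import Relation.Nullary.Negation.Core using (¬_)

sumℤ : {A : Set} → List A → (A → ℤ) → ℤ
sumℤ xs f = List.foldr (λ a s → f a ℤ.+ s) 0ℤ xs

syntax sumℤ xs (λ a → e) = ∑ℤ[ a ∈ xs ] e

vectors : {A : Set} → List A → (n : ℕ) → List (Vec A n)
vectors as zero    = [] ∷ []
vectors as (suc n) = cartesianProductWith _∷_ as (vectors as n)

subsets : (n : ℕ) → List (Subset n)
subsets = vectors (true ∷ false ∷ [])

-- An element is a formal sum of terms k·m, possibly with repetitions, so
-- the equality of the ring is _≋_ and not _≡_.  Laurent polynomials arise
-- from the monoid (ℤ , +), noncommutative polynomials from words.

module MonoidRing (M : Monoid 0ℓ 0ℓ) (_≟_ : Decidable (Monoid._≈_ M)) where

  open Monoid M using (_∙_; ε) renaming (Carrier to ∣M∣)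

  Elem : Set
  Elem = List (ℤ × ∣M∣)

  coeff : ∣M∣ → Elem → ℤ
  coeff m p = ∑ℤ[ (k , m′) ∈ p ] (if does (m′ ≟ m) then k else 0ℤ)

  infix 4 _≋_
  _≋_ : Rel Elem 0ℓ
  p ≋ q = ∀ m → coeff m p ≡ coeff m q

  0# : Elem
  0# = []

  monomial : ∣M∣ → Elem
  monomial m = (1ℤ , m) ∷ []

  1# : Elem
  1# = monomial ε

  infixl 6 _⊕_
  _⊕_ : Elem → Elem → Elem
  _⊕_ = _++_

  infixr 7 _·_
  _·_ : ℤ → Elem → Elem
  k · p = List.map (map₁ (k ℤ.*_)) p

  infixl 7 _⊛_
  _⊛_ : Elem → Elem → Elem
  _⊛_ = cartesianProductWith λ (k , m) (l , m′) → k ℤ.* l , m ∙ m′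

  infixr 8 _↑_
  _↑_ : Elem → ℕ → Elem
  p ↑ zero  = 1#
  p ↑ suc k = p ⊛ p ↑ k

  sum : {A : Set} → List A → (A → Elem) → Elem
  sum xs f = concatMap f xs

  infix 5 sum
  syntax sum xs (λ a → e) = ∑[ a ∈ xs ] e

  product : List Elem → Elem
  product = List.foldr _⊛_ 1#

data AB : Set where
  a b : AB

_≟ab_ : DecidableEquality AB
a ≟ab a = yes refl
a ≟ab b = no λ ()
b ≟ab a = no λ ()
b ≟ab b = yes refl

data CD : Set where
  c d : CD

_≟cd_ : DecidableEquality CD
c ≟cd c = yes refl
c ≟cd d = no λ ()
d ≟cd c = no λ ()
d ≟cd d = yes refl

module ℤ⟨ab⟩ = MonoidRing (++-monoid AB) (≡-dec _≟ab_)

module ℤ⟨cd⟩ = MonoidRing (++-monoid CD) (≡-dec _≟cd_)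

-- A finite poset is taken, up to isomorphism, on the carrier Fin size.
-- The minimum and the maximum are unique by antisymmetry.

record GradedPoset : Set₁ where
  infix 4 _≤_
  field
    size              : ℕ
    _≤_               : Rel (Fin size) 0ℓ
    isDecPartialOrder : IsDecPartialOrder _≡_ _≤_

  open IsDecPartialOrder isDecPartialOrder public
    using (_≟_; _≤?_; isPartialOrder)
  open ToStrict _≡_ _≤_ public using (_<_)

  infix 4 _<?_
  _<?_ : Decidable _<_
  _<?_ = ToStrict.<-decidable _≡_ _≤_ _≟_ _≤?_

  infix 4 _⋖_
  _⋖_ : Rel (Fin size) 0ℓ
  u ⋖ v = u < v × ¬ ∃ λ z → u < z × z < v

  field
    0̂ 1̂      : Fin size
    minimum  : Minimum _≤_ 0̂
    maximum  : Maximum _≤_ 1̂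
    ρ        : Fin size → ℕ
    ρ-0̂      : ρ 0̂ ≡ 0
    ρ-covers : ∀ {u v} → u ⋖ v → ρ v ≡ suc (ρ u)

  rank : ℕ
  rank = ρ 1̂

  elements : List (Fin size)
  elements = allFin size

  interval : Fin size → Fin size → List (Fin size)
  interval u v = filter (λ z → (u ≤? z) ×-dec (z ≤? v)) elements

Eulerian : GradedPoset → Set
Eulerian P = ∀ {u v} → u < v → ∑ℤ[ z ∈ interval u v ] (-1ℤ ℤ.^ ρ z) ≡ 0ℤ
  where open GradedPoset P

-- The index i : Fin n of a subset of [1,n] stands for the number 1 + i.

module _ (P : GradedPoset) {n : ℕ} where
  open GradedPoset P

  RankIn : Subset n → Fin size → Set
  RankIn S u = ∃ λ i → i ∈ S × ρ u ≡ suc (toℕ i)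

  ChainIn : Subset n → Subset size → Set
  ChainIn S C = (∀ u → u ∈ C → RankIn S u)
              × (∀ u → u ∈ C → ∀ v → v ∈ C → u ≤ v ⊎ v ≤ u)

  MaximalChainIn : Subset n → Subset size → Set
  MaximalChainIn S C = ChainIn S C × ¬ ∃ λ C′ → C ⊂ C′ × ChainIn S C′

  chainIn? : ∀ S C → Dec (ChainIn S C)
  chainIn? S C =
    all? (λ u → (u ∈? C) →-dec any? λ i → (i ∈? S) ×-dec (ρ u ℕ.≟ suc (toℕ i)))
    ×-dec
    all? (λ u → (u ∈? C) →-dec all? λ v → (v ∈? C) →-dec ((u ≤? v) ⊎-dec (v ≤? u)))

  maximalChainIn? : ∀ S C → Dec (MaximalChainIn S C)
  maximalChainIn? S C =
    chainIn? S C ×-dec ¬? (anySubset? λ C′ → (C ⊂? C′) ×-dec chainIn? S C′)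

  flag-f : Subset n → ℕ
  flag-f S = length (filter (maximalChainIn? S) (subsets size))

  flag-h : Subset n → ℤ
  flag-h S = ∑ℤ[ T ∈ filter (_⊆? S) (subsets n) ]
               (-1ℤ ℤ.^ (∣ S ∣ ℕ.∸ ∣ T ∣) ℤ.* + flag-f T)

subsetWord : ∀ {n} → Subset n → List AB
subsetWord S = Vec.toList (Vec.map (if_then b else a) S)

abIndex : GradedPoset → ℕ → ℤ⟨ab⟩.Elem
abIndex P n = ∑[ S ∈ subsets n ] flag-h P S · monomial (subsetWord S)
  where open ℤ⟨ab⟩

letter-ab : CD → ℤ⟨ab⟩.Elem
letter-ab c = monomial (a ∷ []) ⊕ monomial (b ∷ [])
  where open ℤ⟨ab⟩
letter-ab d = monomial (a ∷ b ∷ []) ⊕ monomial (b ∷ a ∷ [])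
  where open ℤ⟨ab⟩

-- Φ ↦ Φ(a + b, ab + ba)
evaluate-cd : ℤ⟨cd⟩.Elem → ℤ⟨ab⟩.Elem
evaluate-cd Φ = ∑[ (k , w) ∈ Φ ] k · product (List.map letter-ab w)
  where open ℤ⟨ab⟩

IsCDIndex : GradedPoset → ℕ → ℤ⟨cd⟩.Elem → Set
IsCDIndex P n Φ = evaluate-cd Φ ℤ⟨ab⟩.≋ abIndex P n

open module ℤ[x,x⁻¹] = MonoidRing ℤ.+-0-monoid ℤ._≟_ public

Laurent : Set
Laurent = ℤ[x,x⁻¹].Elem

x^_ : ℤ → Laurent
x^ k = monomial k

-- p(x) ↦ p(xᵉ)
substitute-x^ : ℤ → Laurent → Laurent
substitute-x^ e = List.map (map₂ (e ℤ.*_))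

discardNegative : Laurent → Laurent
discardNegative = filter λ (_ , i) → 0ℤ ℤ.≤? i

-- The value at rank 0 is 1 by convention.  At rank n + 1 it is h n.
byRank : ℕ → (ℕ → Laurent) → Laurent
byRank zero    _ = 1#
byRank (suc n) h = h n

truncatedDifference : ℕ → Laurent → Laurent
truncatedDifference n f =
  ∑[ i ∈ upTo (suc ⌊ n /2⌋) ] (coeff (+ i) f ℤ.- coeff (+ i ℤ.- 1ℤ) f) · (x^ (+ i))

module _ (P : GradedPoset) where
  open GradedPoset P

  -- For p of rank n + 1, toric-f and toric-g below are f([0̂,p),x) and
  -- g([0̂,p),x) of the Eulerian poset [0̂,p], whose rank function is the
  -- restriction of ρ.

  mutual
    toric-f-acc : ∀ p → Acc _<_ p → Laurent
    toric-f-acc p ac = byRank (ρ p) λ n → ∑[ q ∈ elements ] toric-term n ac q (q <? p)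

    toric-term : ∀ {p} → ℕ → Acc _<_ p → ∀ q → Dec (q < p) → Laurent
    toric-term n (acc rs) q (yes q<p) = toric-g-acc q (rs q<p) ⊛ (x^ 1ℤ ⊕ -1ℤ · 1#) ↑ (n ℕ.∸ ρ q)
    toric-term n _        q (no  _)   = 0#

    toric-g-acc : ∀ p → Acc _<_ p → Laurent
    toric-g-acc p ac = byRank (ρ p) λ n → truncatedDifference n (toric-f-acc p ac)

  <-wellFounded : WellFounded _<_
  <-wellFounded = po-wellFounded isPartialOrder

  toric-f : Fin size → Laurent
  toric-f p = toric-f-acc p (<-wellFounded p)

  toric-g : Fin size → Laurent
  toric-g p = toric-g-acc p (<-wellFounded p)

-- xⁿ f([0̂,1̂),x⁻²) without its terms of negative degree, where P has rank n + 1.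
-- For Eulerian P this is the unique q of degree n with q(x) = (-1)ⁿ q(-x) and
-- f([0̂,1̂),x²) = xⁿ (q(x) + q(1/x) - q(0)), because f is palindromic.
shortToric : GradedPoset → ℕ → Laurent
shortToric P n =
  discardNegative ((x^ (+ n)) ⊛ substitute-x^ (ℤ.- (+ 2)) (toric-f P (GradedPoset.1̂ P)))

cdWords : ℕ → List (List CD)
cdWords zero          = [] ∷ []
cdWords (suc zero)    = (c ∷ []) ∷ []
cdWords (suc (suc n)) = List.map (c ∷_) (cdWords (suc n)) ++ List.map (d ∷_) (cdWords n)

-- Positions covered by letters d when the word starts at position i
coveredFrom : ℕ → List CD → List ℕ
coveredFrom i []      = []
coveredFrom i (c ∷ w) = coveredFrom (suc i) w
coveredFrom i (d ∷ w) = i ∷ suc i ∷ coveredFrom (suc (suc i)) w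

covered : List CD → List ℕ
covered = coveredFrom 1

[1,_] : ℕ → List ℕ
[1, n ] = List.map suc (upTo n)

signValue : Sign → ℤ
signValue s = s ℤ.◃ 1

-- λs is the sequence λ, a reserved word.
module _ {n : ℕ} (λs : Vec Sign n) where

  -- λ₁ + ⋯ + λᵢ
  partialSum : ℕ → ℤ
  partialSum i = ∑ℤ[ s ∈ List.take i (Vec.toList λs) ] signValue s

  R : List ℕ
  R = filter (λ i → partialSum i ℤ.≟ 0ℤ) [1, n ]

  R-1 : List ℕ
  R-1 = List.map ℕ.pred R

open DecMembership ℕ._≟_ using () renaming (_∈_ to _∈ᴸ_; _∈?_ to _∈ᴸ?_)

SameSet : List ℕ → List ℕ → Set
SameSet xs ys = All (_∈ᴸ ys) xs × All (_∈ᴸ xs) ys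

Admissible : List CD → ∀ {n} → Vec Sign n → Set
Admissible w {n} λs =
    SameSet (covered w) (R λs ++ R-1 λs)
  × All (λ i → 0ℤ ℤ.≤ partialSum λs i) [1, n ]

admissible? : ∀ w {n} (λs : Vec Sign n) → Dec (Admissible w λs)
admissible? w {n} λs =
  (All.all? (_∈ᴸ? (R λs ++ R-1 λs)) (covered w) ×-dec All.all? (_∈ᴸ? covered w) (R λs ++ R-1 λs))
  ×-dec All.all? (λ i → 0ℤ ℤ.≤? partialSum λs i) [1, n ]

factor : Sign → Laurent
factor Sign.- = -1ℤ · (x^ -1ℤ)
factor Sign.+ = x^ 1ℤ

weight : ∀ {n} → Vec Sign n → Laurent
weight λs = -1ℤ ℤ.^ length (R λs) · product (List.map factor (Vec.toList λs))

-- t(w,x) for a word w of degree n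
wordPolynomial : ℕ → List CD → Laurent
wordPolynomial n w =
  ∑[ λs ∈ filter (admissible? w) (vectors (Sign.+ ∷ Sign.- ∷ []) n) ] weight λs

{-# OPTIONS --safe #-}
-- Unfolding the recursion for f and g turns every chain of the poset into a sum over
-- walks on ℤ with steps ±1, where taking g forces the walk to be positive at the rank
-- of each chain element.  This gives Fine's formula: xⁿ f(x⁻²) is the sum over S of
-- (-1)^|S| f_S times the signed number of walks that are positive at the times in S.
-- Grouping by the exact set S(λ) of positive times of a walk λ replaces f_S by h_S(λ),
-- which is read off the cd-index: [w]Φ contributes to it exactly when each letter d of
-- w covers one time in S(λ) and one outside, that is, when λ is at heights {0,1} there.
-- Folding the walks at height 0, under which the signs of the walks that touch 0
-- elsewhere cancel, leaves the admissible λ once the negative exponents are discarded.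
module Submission where

open import Defs
open import Algebra.Bundles using (Monoid)
open import Data.Bool.Base using (Bool; true; false; if_then_else_)
open import Data.Empty using (⊥-elim)
open import Data.Fin.Base using (Fin; zero; suc; toℕ)
open import Data.Fin.Induction using (po-noetherian)
open import Data.Fin.Properties using (any?; toℕ<n)
open import Data.Fin.Subset using (Subset; _∈_; _∉_; _⊆_; ⊥; ⁅_⁆; _∪_; _─_; ∣_∣) renaming (_-_ to _∖_)
open import Data.Fin.Subset.Properties
  using (_∈?_; _⊆?_; ∉⊥; ⊆-antisym; x∈p∪q⁻; x∈p∪q⁺; x∈⁅x⁆; x∈⁅y⁆⇒x≡y; x∈p∧x≢y⇒x∈p-y; p─q⊆p; p⊆q⇒∣p∣≤∣q∣)
open import Data.Integer.Base as ℤ using (ℤ; -[1+_]; 0ℤ; 1ℤ; -1ℤ; _+_; _-_; _*_; -_)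
import Data.Integer.Properties as ℤ
open import Data.Integer.Tactic.RingSolver using (solve-∀)
open import Data.List.Base as List using (List; []; _∷_; _++_; length; filter; map; concatMap; upTo)
open import Data.List.Membership.Propositional using (find; lose) renaming (_∈_ to _∈ₗ_)
open import Data.List.Membership.Propositional.Properties
  using (∈-allFin; ∈-upTo⁺; ∈-upTo⁻; ∈-filter⁺; ∈-filter⁻; ∈-map⁺; ∈-map⁻; ∈-++⁺ˡ; ∈-++⁺ʳ; ∈-++⁻;
         ∈-concatMap⁺; ∈-concatMap⁻; ∈-cartesianProductWith⁺)
open import Data.List.Membership.Propositional.Properties.WithK using (unique∧set⇒bag)
open import Data.List.Properties
  using (++-monoid; ≡-dec; ∷-injectiveʳ; length-++; length-map; concatMap-cong; filter-≐; map-applyUpTo)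
open import Data.List.Relation.Binary.BagAndSetEquality using (∼bag⇒↭)
open import Data.List.Relation.Binary.Permutation.Propositional.Properties using (↭-length)
open import Data.List.Relation.Unary.All as All using (All; []; _∷_)
import Data.List.Relation.Unary.All.Properties as All
open import Data.List.Relation.Unary.AllPairs using ([]; _∷_)
open import Data.List.Relation.Unary.Any using (here; there)
open import Data.List.Relation.Unary.Unique.Propositional using (Unique)
open import Data.List.Relation.Unary.Unique.Propositional.Properties as Unique using ()
open import Data.Nat.Base as ℕ using (ℕ; zero; suc; ⌊_/2⌋)
import Data.Nat.Properties as ℕ
open import Data.Product.Base using (_×_; _,_; proj₁; proj₂; ∃; map₁)
open import Data.Sign.Base as Sign using (Sign)
open import Data.Sum.Base as Sum using (_⊎_; inj₁; inj₂; [_,_]′)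
open import Data.Vec.Base as Vec using (Vec; []; _∷_)
open import Data.Vec.Properties using (∷-injective)
open import Function.Base using (_∘_; id; flip)
open import Function.Bundles using (mk⇔)
open import Induction.WellFounded using (Acc; acc)
open import Level using (0ℓ)
import Relation.Binary.Construct.NonStrictToStrict as ToStrict
open import Relation.Binary.Definitions using (Decidable; tri<; tri≈; tri>)
open import Relation.Binary.PropositionalEquality
  using (_≡_; _≢_; refl; sym; trans; cong; cong₂; subst; _≗_; module ≡-Reasoning)
open import Relation.Binary.Structures using (IsPartialOrder; IsStrictPartialOrder)
open import Relation.Nullary.Decidable using (Dec; yes; no; does; _×-dec_)
open import Relation.Nullary.Negation.Core using (¬_; contradiction)
open import Relation.Unary using (Pred) renaming (Decidable to Decidable₁)

open ≡-Reasoning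

-- The truncation that defines g does not commute with multiplication by powers of x - 1, so the
-- recursion cannot be solved by polynomial algebra. Dually both operations are local: a polynomial
-- acts on test functions `ℤ → ℤ`, an exponent being a height. With the scaling xʳ p(x⁻²), where r
-- is ρ(p) for g and ρ(p) - 1 for f, the power (x - 1)ˡ becomes (x⁻¹ - x)ˡ, that is, l steps of
-- which those up carry a sign, and the degree bound of g becomes positivity of the height. These
-- signs differ from those of `weight`, where the steps down are negative. The factor (-1)^|S(λ)|
-- reverses the sign of each step that arrives at a positive height, so above 0 the two conventions
-- agree. A step down to 0 is not reversed, which is the origin of the extra factor -1 for each
-- element of R(λ). Below 0 nothing is reversed, so a step and its mirror image have equal signs,
-- except that the steps from 1 and from -1 to 0 have opposite ones; this is the source of the
-- cancellation.

private variable
  A B : Set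

-- Finite sums and pairings

when : Bool → ℤ → ℤ
when t x = if t then x else 0ℤ

when-0 : ∀ t → when t 0ℤ ≡ 0ℤ
when-0 true  = refl
when-0 false = refl

when-minus : ∀ t x y → when t (x - y) ≡ when t x - when t y
when-minus true  x y = refl
when-minus false x y = refl

when-comm : ∀ s t x → when s (when t x) ≡ when t (when s x)
when-comm true  t     x = refl
when-comm false true  x = refl
when-comm false false x = refl

when-* : ∀ t k x → when t (k * x) ≡ k * when t x
when-* true  k x = refl
when-* false k x = sym (ℤ.*-zeroʳ k)

when-cong : ∀ {P Q : Set} (P? : Dec P) (Q? : Dec Q) → (P → Q) → (Q → P) →
            ∀ {x y} → (P → x ≡ y) → when (does P?) x ≡ when (does Q?) y
when-cong (yes p) (yes q) _ _ eq = eq p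
when-cong (yes p) (no ¬q) f _ eq = contradiction (f p) ¬q
when-cong (no ¬p) (yes q) _ g eq = contradiction (g q) ¬p
when-cong (no _)  (no _)  _ _ eq = refl

when-yes : ∀ {P : Set} (P? : Dec P) → P → ∀ {x} → when (does P?) x ≡ x
when-yes (yes _) _ = refl
when-yes (no ¬p) p = contradiction p ¬p

when-no : ∀ {P : Set} (P? : Dec P) → ¬ P → ∀ {x} → when (does P?) x ≡ 0ℤ
when-no (yes p) ¬p = contradiction p ¬p
when-no (no _)  _  = refl

-- Unlike sumℤ, a fold, this sum stays folded on a variable list, so that the
-- summand can be inferred by unification.
Sum : List A → (A → ℤ) → ℤ
Sum []       f = 0ℤ
Sum (x ∷ xs) f = f x + Sum xs f

sumℤ≡Sum : ∀ (xs : List A) (f : A → ℤ) → sumℤ xs f ≡ Sum xs f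
sumℤ≡Sum []       f = refl
sumℤ≡Sum (x ∷ xs) f = cong (f x +_) (sumℤ≡Sum xs f)

sum-cong-∈ : ∀ (xs : List A) {f g : A → ℤ} → (∀ e → e ∈ₗ xs → f e ≡ g e) → Sum xs f ≡ Sum xs g
sum-cong-∈ []       eq = refl
sum-cong-∈ (e ∷ xs) eq = cong₂ _+_ (eq e (here refl)) (sum-cong-∈ xs λ e′ → eq e′ ∘ there)

sum-cong : ∀ (xs : List A) {f g : A → ℤ} → f ≗ g → Sum xs f ≡ Sum xs g
sum-cong xs eq = sum-cong-∈ xs λ e _ → eq e

sum-++ : ∀ (xs {ys} : List A) {f : A → ℤ} → Sum (xs ++ ys) f ≡ Sum xs f + Sum ys f
sum-++ []       = sym (ℤ.+-identityˡ _)
sum-++ (x ∷ xs) {f = f} = trans (cong (f x +_) (sum-++ xs)) (sym (ℤ.+-assoc (f x) _ _))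

sum-map : ∀ (g : B → A) xs {f : A → ℤ} → Sum (map g xs) f ≡ Sum xs (f ∘ g)
sum-map g []       = refl
sum-map g (x ∷ xs) {f} = cong (f (g x) +_) (sum-map g xs)

sum-concatMap : ∀ (g : B → List A) xs {f : A → ℤ} →
                Sum (concatMap g xs) f ≡ Sum xs (λ x → Sum (g x) f)
sum-concatMap g []       = refl
sum-concatMap g (x ∷ xs) = trans (sum-++ (g x)) (cong (Sum (g x) _ +_) (sum-concatMap g xs))

sum-filter : ∀ {P : Pred A 0ℓ} (P? : Decidable₁ P) xs {f : A → ℤ} →
             Sum (filter P? xs) f ≡ Sum xs (λ e → when (does (P? e)) (f e))
sum-filter P? []       = refl
sum-filter P? (x ∷ xs) {f} with does (P? x)
... | true  = cong (f x +_) (sum-filter P? xs)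
... | false = trans (sum-filter P? xs) (sym (ℤ.+-identityˡ _))

sum-0 : ∀ (xs : List A) → Sum xs (λ _ → 0ℤ) ≡ 0ℤ
sum-0 []       = refl
sum-0 (x ∷ xs) = trans (ℤ.+-identityˡ _) (sum-0 xs)

sum-+ : ∀ (xs : List A) (f g : A → ℤ) → Sum xs (λ e → f e + g e) ≡ Sum xs f + Sum xs g
sum-+ []       f g = refl
sum-+ (x ∷ xs) f g = trans (cong (f x + g x +_) (sum-+ xs f g)) (interchange (f x) (g x) _ _)
  where
  interchange : ∀ x y u v → x + y + (u + v) ≡ x + u + (y + v)
  interchange = solve-∀

sum-* : ∀ (xs : List A) k (f : A → ℤ) → Sum xs (λ e → k * f e) ≡ k * Sum xs f
sum-* []       k f = sym (ℤ.*-zeroʳ k)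
sum-* (x ∷ xs) k f = trans (cong (k * f x +_) (sum-* xs k f)) (sym (ℤ.*-distribˡ-+ k (f x) _))

sum-neg : ∀ (xs : List A) (f : A → ℤ) → Sum xs (λ e → - f e) ≡ - Sum xs f
sum-neg []       f = refl
sum-neg (x ∷ xs) f = trans (cong (- f x +_) (sum-neg xs f)) (sym (ℤ.neg-distrib-+ (f x) _))

sum-minus : ∀ (xs : List A) (f g : A → ℤ) → Sum xs (λ e → f e - g e) ≡ Sum xs f - Sum xs g
sum-minus xs f g = trans (sum-+ xs f (λ e → - g e)) (cong (Sum xs f +_) (sum-neg xs g))

sum-swap : ∀ (xs : List A) (ys : List B) (f : A → B → ℤ) →
           Sum xs (λ e → Sum ys (f e)) ≡ Sum ys (λ o → Sum xs (λ e → f e o))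
sum-swap []       ys f = sym (sum-0 ys)
sum-swap (x ∷ xs) ys f =
  trans (cong (Sum ys (f x) +_) (sum-swap xs ys f)) (sym (sum-+ ys (f x) (λ o → Sum xs λ e → f e o)))

when-sum : ∀ t (xs : List A) (f : A → ℤ) → when t (Sum xs f) ≡ Sum xs (λ e → when t (f e))
when-sum true  xs f = refl
when-sum false xs f = sym (sum-0 xs)

length-filter : ∀ {P : Pred A 0ℓ} (P? : Decidable₁ P) xs →
 ℤ.+ length (filter P? xs) ≡ Sum xs (λ e → when (does (P? e)) 1ℤ)
length-filter P? []       = refl
length-filter P? (x ∷ xs) with does (P? x)
... | true  = cong (1ℤ +_) (length-filter P? xs)
... | false = trans (length-filter P? xs) (sym (ℤ.+-identityˡ _))

sum-vectors : ∀ (x y : A) n {f : Vec A (suc n) → ℤ} →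
              Sum (vectors (x ∷ y ∷ []) (suc n)) f
              ≡ Sum (vectors (x ∷ y ∷ []) n) (f ∘ (x ∷_)) + Sum (vectors (x ∷ y ∷ []) n) (f ∘ (y ∷_))
sum-vectors x y n = trans (sum-++ (map (x ∷_) vs)) (cong₂ _+_ (sum-map (x ∷_) vs)
  (trans (sum-++ (map (y ∷_) vs)) (trans (ℤ.+-identityʳ _) (sum-map (y ∷_) vs))))
  where vs = vectors (x ∷ y ∷ []) n

module Pairing (M : Monoid 0ℓ 0ℓ) (_≟_ : Decidable (Monoid._≈_ M)) where

  open Monoid M using (_∙_; ε) renaming (Carrier to ∣M∣)
  private module R = MonoidRing M _≟_

  -- The linear extension of `φ` to formal sums. Products become nested pairings and terms are never
  -- collected; coefficients, which define the equality of the ring, reappear as the test functions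
  -- `δ m`.
  pair : R.Elem → (∣M∣ → ℤ) → ℤ
  pair p φ = Sum p λ (k , m) → k * φ m

  δ : ∣M∣ → ∣M∣ → ℤ
  δ m m′ = when (does (m′ ≟ m)) 1ℤ

  coeff-pair : ∀ m p → R.coeff m p ≡ pair p (δ m)
  coeff-pair m p = trans (sumℤ≡Sum p (λ (k , m′) → when (does (m′ ≟ m)) k)) (sum-cong p λ (k , m′) →
    trans (cong (when _) (sym (ℤ.*-identityʳ k))) (when-* _ k 1ℤ))

  pair-cong : ∀ p {φ ψ} → φ ≗ ψ → pair p φ ≡ pair p ψ
  pair-cong p eq = sum-cong p λ (k , m) → cong (k *_) (eq m)

  pair-· : ∀ k p {φ} → pair (k R.· p) φ ≡ k * pair p φ
  pair-· k p {φ} = trans (sum-map (map₁ (k *_)) p)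
    (trans (sum-cong p λ (l , m) → ℤ.*-assoc k l (φ m)) (sum-* p k _))

  pair-monomial : ∀ m {φ} → pair (R.monomial m) φ ≡ φ m
  pair-monomial m = trans (ℤ.+-identityʳ _) (ℤ.*-identityˡ _)

  pair-⊛ : ∀ p q {φ} → pair (p R.⊛ q) φ ≡ pair p (λ m → pair q (λ m′ → φ (m ∙ m′)))
  pair-⊛ []            q     = refl
  pair-⊛ ((k , m) ∷ p) q {φ} = trans (sum-++ (map _ q)) (cong₂ _+_ head (pair-⊛ p q))
    where
    head = trans (sum-map _ q) (trans (sum-cong q λ (l , m′) → ℤ.*-assoc k l (φ (m ∙ m′))) (sum-* q k _))

  pair-sumˡ : ∀ (xs : List A) (f : A → R.Elem) {φ} → pair (R.sum xs f) φ ≡ Sum xs (λ e → pair (f e) φ)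
  pair-sumˡ xs f = sum-concatMap f xs

  pair-minus : ∀ p (φ ψ : ∣M∣ → ℤ) → pair p (λ m → φ m - ψ m) ≡ pair p φ - pair p ψ
  pair-minus p φ ψ = trans (sum-cong p λ (k , m) → distrib k (φ m) (ψ m)) (sum-minus p _ _)
    where
    distrib : ∀ k x y → k * (x - y) ≡ k * x - k * y
    distrib = solve-∀

  pair-* : ∀ p k (φ : ∣M∣ → ℤ) → pair p (λ m → k * φ m) ≡ k * pair p φ
  pair-* p k φ = trans (sum-cong p λ (l , m) → swap l k (φ m)) (sum-* p k _)
    where
    swap : ∀ l k x → l * (k * x) ≡ k * (l * x)
    swap = solve-∀

  pair-sumʳ : ∀ p (xs : List A) (φ : A → ∣M∣ → ℤ) →
              pair p (λ m → Sum xs (λ e → φ e m)) ≡ Sum xs (λ e → pair p (φ e))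
  pair-sumʳ p xs φ = trans (sum-cong p λ (k , m) → sym (sum-* xs k (λ e → φ e m))) (sum-swap p xs _)

  coeff-· : ∀ m k p → R.coeff m (k R.· p) ≡ k * R.coeff m p
  coeff-· m k p = trans (coeff-pair m (k R.· p)) (trans (pair-· k p) (cong (k *_) (sym (coeff-pair m p))))

  coeff-sum : ∀ m (xs : List A) (f : A → R.Elem) → R.coeff m (R.sum xs f) ≡ Sum xs (R.coeff m ∘ f)
  coeff-sum m xs f = trans (sumℤ≡Sum (R.sum xs f) (λ (k , m′) → when (does (m′ ≟ m)) k))
    (trans (sum-concatMap f xs) (sum-cong xs λ x → sym (sumℤ≡Sum (f x) (λ (k , m′) → when (does (m′ ≟ m)) k))))

-- Chains of a graded poset

unique-map : ∀ {f : A → B} {xs} → (∀ {x y} → x ∈ₗ xs → y ∈ₗ xs → f x ≡ f y → x ≡ y) →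
             Unique xs → Unique (map f xs)
unique-map inj []       = []
unique-map inj (x∉ ∷ u) =
  All.map⁺ (All.tabulate λ y∈ fx≡fy → All.lookup x∉ y∈ (inj (here refl) (there y∈) fx≡fy))
  ∷ unique-map (λ x∈ y∈ → inj (there x∈) (there y∈)) u

unique-concatMap : ∀ {g : A → List B} {xs} → Unique xs → (∀ {x} → x ∈ₗ xs → Unique (g x)) →
                   (∀ {x y z} → x ∈ₗ xs → y ∈ₗ xs → z ∈ₗ g x → z ∈ₗ g y → x ≡ y) → Unique (concatMap g xs)
unique-concatMap         []       _  _   = []
unique-concatMap {g = g} {x ∷ xs} (x∉ ∷ u) ug inj =
  Unique.++⁺ (ug (here refl)) (unique-concatMap u (ug ∘ there) λ x∈ y∈ → inj (there x∈) (there y∈))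
    λ (z∈gx , z∈) → let y , y∈ , z∈gy = find (∈-concatMap⁻ g {xs = xs} z∈) in
      All.lookup x∉ y∈ (inj (here refl) (there y∈) z∈gx z∈gy)

length-unique : ∀ {xs ys : List A} → Unique xs → Unique ys →
                (∀ {x} → x ∈ₗ xs → x ∈ₗ ys) → (∀ {x} → x ∈ₗ ys → x ∈ₗ xs) → length xs ≡ length ys
length-unique u v f g = ↭-length (∼bag⇒↭ (unique∧set⇒bag u v (mk⇔ f g)))

length-concatMap : ∀ (g : B → List A) xs → ℤ.+ length (concatMap g xs) ≡ Sum xs (λ x → ℤ.+ length (g x))
length-concatMap g []       = refl
length-concatMap g (x ∷ xs) =
  trans (cong (ℤ.+_) (length-++ (g x))) (cong (ℤ.+ length (g x) +_) (length-concatMap g xs))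

unique-subsets : ∀ n → Unique (subsets n)
unique-subsets zero    = [] ∷ []
unique-subsets (suc n) =
  Unique.cartesianProductWith⁺ _∷_ ∷-injective (((λ ()) ∷ []) ∷ [] ∷ []) (unique-subsets n)

∈-subsets : ∀ {n} (S : Subset n) → S ∈ₗ subsets n
∈-subsets []                  = here refl
∈-subsets {suc n} (true  ∷ S) =
  ∈-cartesianProductWith⁺ _∷_ {xs = true ∷ false ∷ []} {ys = subsets n} (here refl) (∈-subsets S)
∈-subsets {suc n} (false ∷ S) =
  ∈-cartesianProductWith⁺ _∷_ {xs = true ∷ false ∷ []} {ys = subsets n} (there (here refl)) (∈-subsets S)

x∈p─q⇒x∉q : ∀ {n} (p q : Subset n) {x} → x ∈ p ─ q → x ∉ q
x∈p─q⇒x∉q (s ∷ p) (false ∷ q) (Vec.there x∈) (Vec.there x∈q) = x∈p─q⇒x∉q p q x∈ x∈q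
x∈p─q⇒x∉q (s ∷ p) (true  ∷ q) (Vec.there x∈) (Vec.there x∈q) = x∈p─q⇒x∉q p q x∈ x∈q

module GradedPosetProperties (P : GradedPoset) where
  open GradedPoset P
  private
    module ≤ = IsPartialOrder isPartialOrder
    module < = IsStrictPartialOrder (ToStrict.<-isStrictPartialOrder _≡_ _≤_ isPartialOrder)

  -- The rank function is constrained on covers only, so monotonicity and interpolation both descend
  -- from `v` along covers that stay above `u`.
  coatom-above : ∀ {u v} → u < v → ∃ λ z → u ≤ z × z ⋖ v
  coatom-above {v = v} = go (po-noetherian isPartialOrder _)
    where
    go : ∀ {u} → Acc (flip _<_) u → u < v → ∃ λ z → u ≤ z × z ⋖ v
    go {u} (acc rs) u<v with any? (λ z → (u <? z) ×-dec (z <? v))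
    ... | no  u⋖v               = u , ≤.refl , u<v , u⋖v
    ... | yes (z , u<z , z<v) with go (rs u<z) z<v
    ...   | w , z≤w , w⋖v = w , ≤.trans (proj₁ u<z) z≤w , w⋖v

  ρ-mono-< : ∀ {u v} → u < v → ρ u ℕ.< ρ v
  ρ-mono-< = go (<-wellFounded P _)
    where
    go : ∀ {u v} → Acc _<_ v → u < v → ρ u ℕ.< ρ v
    go {u} (acc rs) u<v with coatom-above u<v
    ... | z , u≤z , z⋖v with u ≟ z
    ...   | yes refl = ℕ.≤-reflexive (sym (ρ-covers z⋖v))
    ...   | no  u≢z  =
      ℕ.<-trans (go (rs (proj₁ z⋖v)) (u≤z , u≢z)) (ℕ.≤-reflexive (sym (ρ-covers z⋖v)))

  -- The descent from `v` lowers the rank by one at a time, so `r` cannot be skipped, and `u` is not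
  -- met before since its rank is below `r`.
  interpolate : ∀ {u v r} → u < v → ρ u ℕ.< r → r ℕ.< ρ v → ∃ λ z → u < z × z < v × ρ z ≡ r
  interpolate = go (<-wellFounded P _)
    where
    go : ∀ {u v r} → Acc _<_ v → u < v → ρ u ℕ.< r → r ℕ.< ρ v → ∃ λ z → u < z × z < v × ρ z ≡ r
    go {u} {v} {r} (acc rs) u<v ρu<r r<ρv with coatom-above u<v
    ... | z , u≤z , z⋖v with ℕ.m≤n⇒m<n∨m≡n (ℕ.s≤s⁻¹ (subst (r ℕ.<_) (ρ-covers z⋖v) r<ρv))
    ...   | inj₂ refl = z , (u≤z , λ { refl → ℕ.<-irrefl refl ρu<r }) , proj₁ z⋖v , refl
    ...   | inj₁ r<ρz
      with go (rs (proj₁ z⋖v)) (u≤z , λ { refl → ℕ.<-asym ρu<r r<ρz }) ρu<r r<ρz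
    ...     | w , u<w , w<z , ρw≡r = w , u<w , <.trans w<z (proj₁ z⋖v) , ρw≡r

  ρ≡0⇒≡0̂ : ∀ {u} → ρ u ≡ 0 → u ≡ 0̂
  ρ≡0⇒≡0̂ {u} ρu≡0 with 0̂ ≟ u
  ... | yes 0̂≡u = sym 0̂≡u
  ... | no  0̂≢u = ⊥-elim (ℕ.n≮0 (subst (ρ 0̂ ℕ.<_) ρu≡0 (ρ-mono-< (minimum u , 0̂≢u))))

  comparable∧ρ<⇒< : ∀ {u v} → u ≤ v ⊎ v ≤ u → ρ u ℕ.< ρ v → u < v
  comparable∧ρ<⇒< (inj₁ u≤v) ρu<ρv = u≤v , λ { refl → ℕ.<-irrefl refl ρu<ρv }
  comparable∧ρ<⇒< {u} {v} (inj₂ v≤u) ρu<ρv with v ≟ u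
  ... | yes refl = contradiction ρu<ρv (ℕ.<-irrefl refl)
  ... | no  v≢u  = contradiction (ρ-mono-< (v≤u , v≢u)) (ℕ.<-asym ρu<ρv)

  comparable∧ρ≡⇒≡ : ∀ {u v} → u ≤ v ⊎ v ≤ u → ρ u ≡ ρ v → u ≡ v
  comparable∧ρ≡⇒≡ {u} {v} cmp eq with u ≟ v
  ... | yes u≡v = u≡v
  ... | no  u≢v with cmp
  ...   | inj₁ u≤v = contradiction (ρ-mono-< (u≤v , u≢v)) (ℕ.<-irrefl eq)
  ...   | inj₂ v≤u = contradiction (ρ-mono-< (v≤u , u≢v ∘ sym)) (ℕ.<-irrefl (sym eq))

  successors : ℕ → Fin size → List (Fin size)
  successors r q = filter (λ q′ → (q <? q′) ×-dec (ρ q′ ℕ.≟ suc r)) elements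

  -- The chains above q with one element at each rank of S, where the index i
  -- of S stands for the rank 1 + r + i.
  chains : ∀ {m} → Vec Bool m → ℕ → Fin size → List (Subset size)
  chains []          r q = ⊥ ∷ []
  chains (false ∷ S) r q = chains S (suc r) q
  chains (true  ∷ S) r q = concatMap (λ q′ → map (⁅ q′ ⁆ ∪_) (chains S (suc r) q′)) (successors r q)

  -- For r = 0 and q = `0̂` this describes the maximal chains of P_S, which are defined by
  -- maximality, through the ranks that they occupy. The offset `r` and the lower bound `q` adapt it
  -- to the recursion of `chains`.
  record IsFullChain {m} (S : Vec Bool m) (r : ℕ) (q : Fin size) (C : Subset size) : Set where
    field
      above  : ∀ {u} → u ∈ C → q < u
      total  : ∀ {u v} → u ∈ C → v ∈ C → u ≤ v ⊎ v ≤ u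
      ranked : ∀ {u} → u ∈ C → ∃ λ i → i ∈ S × ρ u ≡ suc (r ℕ.+ toℕ i)
      full   : ∀ {i} → i ∈ S → ∃ λ u → u ∈ C × ρ u ≡ suc (r ℕ.+ toℕ i)

  open IsFullChain

  ∈-insert⁻ : ∀ {n} {x y : Fin n} {C} → x ∈ ⁅ y ⁆ ∪ C → x ≡ y ⊎ x ∈ C
  ∈-insert⁻ {y = y} {C} x∈ with x∈p∪q⁻ ⁅ y ⁆ C x∈
  ... | inj₁ x∈⁅y⁆ = inj₁ (x∈⁅y⁆⇒x≡y y x∈⁅y⁆)
  ... | inj₂ x∈C   = inj₂ x∈C

  ∈-chains-inside⁻ : ∀ {m} (S : Vec Bool m) {r q C} → C ∈ₗ chains (true ∷ S) r q →
    ∃ λ q′ → q < q′ × ρ q′ ≡ suc r × ∃ λ C′ → C′ ∈ₗ chains S (suc r) q′ × C ≡ ⁅ q′ ⁆ ∪ C′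
  ∈-chains-inside⁻ S {r} {q} C∈ =
    let q′ , q′∈ , C∈′       = find (∈-concatMap⁻ _ {xs = successors r q} C∈)
        C′ , C′∈ , C≡        = ∈-map⁻ _ C∈′
        _ , q<q′ , ρq′       = ∈-filter⁻ _ {xs = elements} q′∈
    in q′ , q<q′ , ρq′ , C′ , C′∈ , C≡

  chains-sound : ∀ {m} (S : Vec Bool m) {r q C} → C ∈ₗ chains S r q → IsFullChain S r q C
  chains-sound [] (here refl) = record
    { above  = λ u∈ → contradiction u∈ ∉⊥
    ; total  = λ u∈ → contradiction u∈ ∉⊥
    ; ranked = λ u∈ → contradiction u∈ ∉⊥
    ; full   = λ ()
    }
  chains-sound (false ∷ S) {r} C∈ = record
    { above  = above IH
    ; total  = total IH
    ; ranked = λ u∈ → let i , i∈ , eq = ranked IH u∈ in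
                 suc i , Vec.there i∈ , trans eq (cong suc (sym (ℕ.+-suc r _)))
    ; full   = λ { (Vec.there i∈) → let u , u∈ , eq = full IH i∈ in
                 u , u∈ , trans eq (cong suc (sym (ℕ.+-suc r _))) }
    }
    where IH = chains-sound S C∈
  chains-sound (true ∷ S) {r} {q} C∈
    with q′ , q<q′ , ρq′ , C′ , C′∈ , refl ← ∈-chains-inside⁻ S C∈ = record
    { above  = λ u∈ → [ (λ { refl → q<q′ }) , <.trans q<q′ ∘ above IH ]′ (∈-insert⁻ u∈)
    ; total  = λ u∈ v∈ → tot (∈-insert⁻ u∈) (∈-insert⁻ v∈)
    ; ranked = λ u∈ → rnk (∈-insert⁻ u∈)
    ; full   = ful
    }
    where
    IH = chains-sound S C′∈

    tot : ∀ {u v} → u ≡ q′ ⊎ u ∈ C′ → v ≡ q′ ⊎ v ∈ C′ → u ≤ v ⊎ v ≤ u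
    tot (inj₁ refl) (inj₁ refl) = inj₁ ≤.refl
    tot (inj₁ refl) (inj₂ v∈)   = inj₁ (proj₁ (above IH v∈))
    tot (inj₂ u∈)   (inj₁ refl) = inj₂ (proj₁ (above IH u∈))
    tot (inj₂ u∈)   (inj₂ v∈)   = total IH u∈ v∈

    rnk : ∀ {u} → u ≡ q′ ⊎ u ∈ C′ → ∃ λ i → i ∈ (true ∷ S) × ρ u ≡ suc (r ℕ.+ toℕ i)
    rnk (inj₁ refl) = zero , Vec.here , trans ρq′ (cong suc (sym (ℕ.+-identityʳ r)))
    rnk (inj₂ u∈)   = let i , i∈ , eq = ranked IH u∈ in
      suc i , Vec.there i∈ , trans eq (cong suc (sym (ℕ.+-suc r _)))

    ful : ∀ {i} → i ∈ (true ∷ S) → ∃ λ u → u ∈ (⁅ q′ ⁆ ∪ C′) × ρ u ≡ suc (r ℕ.+ toℕ i)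
    ful Vec.here       = q′ , x∈p∪q⁺ (inj₁ (x∈⁅x⁆ q′)) , trans ρq′ (cong suc (sym (ℕ.+-identityʳ r)))
    ful (Vec.there i∈) = let u , u∈ , eq = full IH i∈ in
      u , x∈p∪q⁺ (inj₂ u∈) , trans eq (cong suc (sym (ℕ.+-suc r _)))

  -- If rank 1 + r is selected, the element of `C` at that rank is the head. Deleting it leaves a
  -- full chain above it: the remaining elements are comparable to the head and have larger rank.
  chains-complete : ∀ {m} (S : Vec Bool m) {r q C} → IsFullChain S r q C → C ∈ₗ chains S r q
  chains-complete [] fc =
    here (⊆-antisym (λ u∈ → contradiction (proj₁ (ranked fc u∈)) λ ()) (λ u∈ → contradiction u∈ ∉⊥))
  chains-complete (false ∷ S) {r} fc = chains-complete S record
    { above  = above fc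
    ; total  = total fc
    ; ranked = λ u∈ → case-ranked (ranked fc u∈)
    ; full   = λ i∈ → let u , u∈ , eq = full fc (Vec.there i∈) in
                 u , u∈ , trans eq (cong suc (ℕ.+-suc r _))
    }
    where
    case-ranked : ∀ {u} → (∃ λ i → i ∈ (false ∷ S) × ρ u ≡ suc (r ℕ.+ toℕ i)) →
                  ∃ λ i → i ∈ S × ρ u ≡ suc (suc r ℕ.+ toℕ i)
    case-ranked (suc i , Vec.there i∈ , eq) = i , i∈ , trans eq (cong suc (ℕ.+-suc r _))
  chains-complete (true ∷ S) {r} {q} {C} fc
    with q′ , q′∈C , eq ← full fc Vec.here
    with ρq′ ← trans eq (cong suc (ℕ.+-identityʳ r)) =
    ∈-concatMap⁺ _ (lose (∈-filter⁺ _ (∈-allFin q′) (above fc q′∈C , ρq′))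
      (subst (_∈ₗ map (⁅ q′ ⁆ ∪_) (chains S (suc r) q′)) C≡
        (∈-map⁺ (⁅ q′ ⁆ ∪_) (chains-complete S record
          { above  = λ {u} u∈ → let u∈C , u≢q′ = ∈-delete⁻ u∈
                                    i , i∈ , ρu = rnk u∈C u≢q′ in
              comparable∧ρ<⇒< (total fc q′∈C u∈C)
                (subst (ℕ._< ρ u) (sym ρq′) (subst (suc r ℕ.<_) (sym ρu) (ℕ.s≤s (ℕ.s≤s (ℕ.m≤m+n r _)))))
          ; total  = λ u∈ v∈ → total fc (proj₁ (∈-delete⁻ u∈)) (proj₁ (∈-delete⁻ v∈))
          ; ranked = λ u∈ → let u∈C , u≢q′ = ∈-delete⁻ u∈ in rnk u∈C u≢q′
          ; full   = λ {i} i∈ → let u , u∈C , ρu = full fc (Vec.there i∈) in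
              u , x∈p∧x≢y⇒x∈p-y u∈C (λ { refl →
                ℕ.m≢1+m+n r (ℕ.suc-injective (trans (sym ρq′) (trans ρu (cong suc (ℕ.+-suc r _))))) })
                , trans ρu (cong suc (ℕ.+-suc r _))
          }))))
    where
    ∈-delete⁻ : ∀ {u} → u ∈ C ∖ q′ → u ∈ C × u ≢ q′
    ∈-delete⁻ u∈ = p─q⊆p C ⁅ q′ ⁆ u∈ , λ { refl → x∈p─q⇒x∉q C ⁅ q′ ⁆ u∈ (x∈⁅x⁆ q′) }

    rnk : ∀ {u} → u ∈ C → u ≢ q′ → ∃ λ i → i ∈ S × ρ u ≡ suc (suc r ℕ.+ toℕ i)
    rnk u∈C u≢q′ with ranked fc u∈C
    ... | zero  , _           , ρu = contradiction (comparable∧ρ≡⇒≡ (total fc u∈C q′∈C) (trans ρu (sym eq))) u≢q′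
    ... | suc i , Vec.there i∈ , ρu = i , i∈ , trans ρu (cong suc (ℕ.+-suc r _))

    C≡ : ⁅ q′ ⁆ ∪ (C ∖ q′) ≡ C
    C≡ = ⊆-antisym
      (λ u∈ → [ (λ { refl → q′∈C }) , proj₁ ∘ ∈-delete⁻ ]′ (∈-insert⁻ u∈))
      (λ {u} u∈ → x∈p∪q⁺ (split u u∈))
      where
      split : ∀ u → u ∈ C → u ∈ ⁅ q′ ⁆ ⊎ u ∈ C ∖ q′
      split u u∈ with u ≟ q′
      ... | yes refl = inj₁ (x∈⁅x⁆ q′)
      ... | no  u≢q′ = inj₂ (x∈p∧x≢y⇒x∈p-y u∈ u≢q′)

  chains-ρ : ∀ {m} (S : Vec Bool m) {r q C u} → C ∈ₗ chains S r q → u ∈ C → r ℕ.< ρ u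
  chains-ρ S {r} C∈ u∈ = let _ , _ , ρu = ranked (chains-sound S C∈) u∈ in
    subst (r ℕ.<_) (sym ρu) (ℕ.s≤s (ℕ.m≤m+n r _))

  -- The head is the only element of rank 1 + r in its chain, all others lying higher by `chains-ρ`,
  -- so the set determines both its head and its tail.
  chains-unique : ∀ {m} (S : Vec Bool m) r q → Unique (chains S r q)
  chains-unique []          r q = [] ∷ []
  chains-unique (false ∷ S) r q = chains-unique S (suc r) q
  chains-unique (true  ∷ S) r q = unique-concatMap (Unique.filter⁺ _ (Unique.allFin⁺ size))
    (λ {q′} q′∈ → let _ , _ , ρq′ = ∈-filter⁻ _ {xs = elements} q′∈ in
      unique-map (insert-injective ρq′) (chains-unique S (suc r) q′))
    (λ q₁∈ q₂∈ C∈₁ C∈₂ → heads-agree (proj₂ (proj₂ (∈-filter⁻ _ {xs = elements} q₁∈)))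
      (proj₂ (proj₂ (∈-filter⁻ _ {xs = elements} q₂∈))) (∈-map⁻ _ C∈₁) (∈-map⁻ _ C∈₂))
    where
    insert-⊆ : ∀ {q′ C C′} → ρ q′ ≡ suc r → C ∈ₗ chains S (suc r) q′ →
               ⁅ q′ ⁆ ∪ C ≡ ⁅ q′ ⁆ ∪ C′ → C ⊆ C′
    insert-⊆ ρq′ C∈ eq u∈ with ∈-insert⁻ (subst (_ ∈_) eq (x∈p∪q⁺ (inj₂ u∈)))
    ... | inj₁ refl = contradiction (chains-ρ S C∈ u∈) (ℕ.<-irrefl (sym ρq′))
    ... | inj₂ u∈C′ = u∈C′

    insert-injective : ∀ {q′ C C′} → ρ q′ ≡ suc r → C ∈ₗ chains S (suc r) q′ → C′ ∈ₗ chains S (suc r) q′ →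
                       ⁅ q′ ⁆ ∪ C ≡ ⁅ q′ ⁆ ∪ C′ → C ≡ C′
    insert-injective ρq′ C∈ C′∈ eq = ⊆-antisym (insert-⊆ ρq′ C∈ eq) (insert-⊆ ρq′ C′∈ (sym eq))

    heads-agree : ∀ {q₁ q₂ C} → ρ q₁ ≡ suc r → ρ q₂ ≡ suc r →
                  (∃ λ C₁ → C₁ ∈ₗ chains S (suc r) q₁ × C ≡ ⁅ q₁ ⁆ ∪ C₁) →
                  (∃ λ C₂ → C₂ ∈ₗ chains S (suc r) q₂ × C ≡ ⁅ q₂ ⁆ ∪ C₂) → q₁ ≡ q₂
    heads-agree {q₁} ρq₁ ρq₂ (C₁ , _ , C≡₁) (C₂ , C₂∈ , C≡₂)
      with ∈-insert⁻ (subst (q₁ ∈_) (trans (sym C≡₁) C≡₂) (x∈p∪q⁺ (inj₁ (x∈⁅x⁆ q₁))))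
    ... | inj₁ q₁≡q₂ = q₁≡q₂
    ... | inj₂ q₁∈C₂ = contradiction (chains-ρ S C₂∈ q₁∈C₂) (ℕ.<-irrefl (sym ρq₁))

  -- The flag numbers by recursion on the rank, the state being the last chosen element. This is the
  -- recursion that runs in step with `fine`.
  count : ∀ {m} → ℕ → Fin size → Vec Bool m → ℤ
  count r q []          = 1ℤ
  count r q (false ∷ S) = count (suc r) q S
  count r q (true  ∷ S) =
    Sum elements λ q′ → when (does ((q <? q′) ×-dec (ρ q′ ℕ.≟ suc r))) (count (suc r) q′ S)

  length-chains : ∀ {m} (S : Vec Bool m) r q → ℤ.+ length (chains S r q) ≡ count r q S
  length-chains []          r q = refl
  length-chains (false ∷ S) r q = length-chains S (suc r) q
  length-chains (true  ∷ S) r q =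
    trans (length-concatMap _ (successors r q))
      (trans (sum-cong (successors r q) λ q′ →
          trans (cong (ℤ.+_) (length-map (⁅ q′ ⁆ ∪_) (chains S (suc r) q′))) (length-chains S (suc r) q′))
        (sum-filter _ elements))

  module _ {n} (rank≡ : rank ≡ suc n) {S : Subset n} {C : Subset size} where

    -- An element added to `C` would share its rank with an element of `C`, and comparable elements
    -- of equal rank coincide.
    full⇒maximal : IsFullChain S 0 0̂ C → MaximalChainIn P S C
    full⇒maximal fc =
      ((λ u u∈ → ranked fc u∈) , (λ u u∈ v v∈ → total fc u∈ v∈)) ,
      λ { (C′ , (C⊆C′ , u , u∈C′ , u∉C) , ranked′ , total′) →
          let i , i∈S , ρu = ranked′ u u∈C′
              v , v∈C , ρv = full fc i∈S
          in u∉C (subst (_∈ C) (sym (comparable∧ρ≡⇒≡ (total′ u u∈C′ v (C⊆C′ v∈C)) (trans ρu (sym ρv)))) v∈C) }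

    private
      Comparable : Fin size → Set
      Comparable u = ∀ w → w ∈ C → u ≤ w ⊎ w ≤ u

      -- The candidate starts at `1̂` and moves down through elements of `C`. The last conjunct
      -- holds for both kinds of candidate, and makes the upper neighbour comparable to the lower
      -- one even if that is `0̂`.
      least-above : ∀ r → r ℕ.< rank → (∀ u → u ∈ C → Comparable u) →
        ∃ λ v → r ℕ.< ρ v × (∀ w → w ∈ C → r ℕ.< ρ w → v ≤ w) × (∀ u → Comparable u → u ≤ v ⊎ v ≤ u)
      least-above r r<rank tot = go (<-wellFounded P 1̂) r<rank (λ u _ → inj₁ (maximum u))
        where
        go : ∀ {v} → Acc _<_ v → r ℕ.< ρ v → (∀ u → Comparable u → u ≤ v ⊎ v ≤ u) →
             ∃ λ v → r ℕ.< ρ v × (∀ w → w ∈ C → r ℕ.< ρ w → v ≤ w) × (∀ u → Comparable u → u ≤ v ⊎ v ≤ u)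
        go {v} (acc rs) r<ρv cmp with any? (λ w → (w ∈? C) ×-dec ((r ℕ.<? ρ w) ×-dec (w <? v)))
        ... | yes (w , w∈ , r<ρw , w<v) = go (rs w<v) r<ρw (λ u cmp-u → cmp-u w w∈)
        ... | no ¬∃ = v , r<ρv , least , cmp
          where
          least : ∀ w → w ∈ C → r ℕ.< ρ w → v ≤ w
          least w w∈ r<ρw with cmp w (tot w w∈) | w ≟ v
          ... | inj₂ v≤w | _       = v≤w
          ... | inj₁ w≤v | yes w≡v = ≤.reflexive (sym w≡v)
          ... | inj₁ w≤v | no  w≢v = contradiction (w , w∈ , r<ρw , w≤v , w≢v) ¬∃

      greatest-below : ∀ r → 0 ℕ.< r → (∀ u → u ∈ C → Comparable u) →
        ∃ λ u → ρ u ℕ.< r × (∀ w → w ∈ C → ρ w ℕ.< r → w ≤ u) × Comparable u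
      greatest-below r 0<r tot =
        go (po-noetherian isPartialOrder 0̂) (subst (ℕ._< r) (sym ρ-0̂) 0<r) (λ w _ → inj₁ (minimum w))
        where
        go : ∀ {u} → Acc (flip _<_) u → ρ u ℕ.< r → Comparable u →
             ∃ λ u → ρ u ℕ.< r × (∀ w → w ∈ C → ρ w ℕ.< r → w ≤ u) × Comparable u
        go {u} (acc rs) ρu<r cmp with any? (λ w → (w ∈? C) ×-dec ((ρ w ℕ.<? r) ×-dec (u <? w)))
        ... | yes (w , w∈ , ρw<r , u<w) = go (rs u<w) ρw<r (tot w w∈)
        ... | no ¬∃ = u , ρu<r , greatest , cmp
          where
          greatest : ∀ w → w ∈ C → ρ w ℕ.< r → w ≤ u
          greatest w w∈ ρw<r with cmp w w∈ | u ≟ w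
          ... | inj₂ w≤u | _       = w≤u
          ... | inj₁ u≤w | yes u≡w = ≤.reflexive (sym u≡w)
          ... | inj₁ u≤w | no  u≢w = contradiction (w , w∈ , ρw<r , u≤w , u≢w) ¬∃

    maximal⇒full : MaximalChainIn P S C → IsFullChain S 0 0̂ C
    maximal⇒full ((rnk , tot) , max) = record
      { above  = λ {u} u∈ → let _ , _ , ρu = rnk u u∈ in
          comparable∧ρ<⇒< (inj₁ (minimum u)) (subst (ρ 0̂ ℕ.<_) (sym ρu) (subst (ℕ._< _) (sym ρ-0̂) ℕ.z<s))
      ; total  = λ {u} {v} u∈ v∈ → tot u u∈ v v∈
      ; ranked = λ {u} → rnk u
      ; full   = fills
      }
      where
      -- Otherwise an element of the missing rank, between the nearest
      -- elements of C ∪ {0̂,1̂}, could be added to C.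
      fills : ∀ {i} → i ∈ S → ∃ λ u → u ∈ C × ρ u ≡ suc (toℕ i)
      fills {i} i∈ with any? (λ u → (u ∈? C) ×-dec (ρ u ℕ.≟ suc (toℕ i)))
      ... | yes found = found
      ... | no  ¬found
        with v , r<ρv , least , cmp-v ← least-above (suc (toℕ i)) (subst (suc (toℕ i) ℕ.<_) (sym rank≡) (ℕ.s≤s (toℕ<n i))) tot
        with u , ρu<r , greatest , cmp-u ← greatest-below (suc (toℕ i)) ℕ.z<s tot
        with z , u<z , z<v , ρz ← interpolate (comparable∧ρ<⇒< (cmp-v u cmp-u) (ℕ.<-trans ρu<r r<ρv)) ρu<r r<ρv
        = ⊥-elim (max (⁅ z ⁆ ∪ C , ((λ w∈ → x∈p∪q⁺ (inj₂ w∈)) , z , x∈p∪q⁺ (inj₁ (x∈⁅x⁆ z)) , λ z∈ → ¬found (z , z∈ , ρz))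
            , (λ w w∈ → [ (λ { refl → i , i∈ , ρz }) , rnk w ]′ (∈-insert⁻ w∈))
            , (λ w w∈ w′ w′∈ → tot′ (∈-insert⁻ w∈) (∈-insert⁻ w′∈))))
        where
        z~ : ∀ {w} → w ∈ C → z ≤ w ⊎ w ≤ z
        z~ {w} w∈ with ℕ.<-cmp (ρ w) (suc (toℕ i))
        ... | tri< ρw<r _ _ = inj₂ (≤.trans (greatest w w∈ ρw<r) (proj₁ u<z))
        ... | tri≈ _ ρw≡r _ = contradiction (w , w∈ , ρw≡r) ¬found
        ... | tri> _ _ r<ρw = inj₁ (≤.trans (proj₁ z<v) (least w w∈ r<ρw))

        tot′ : ∀ {w w′} → w ≡ z ⊎ w ∈ C → w′ ≡ z ⊎ w′ ∈ C → w ≤ w′ ⊎ w′ ≤ w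
        tot′ (inj₁ refl) (inj₁ refl) = inj₁ ≤.refl
        tot′ (inj₁ refl) (inj₂ w′∈)  = z~ w′∈
        tot′ (inj₂ w∈)   (inj₁ refl) = Sum.swap (z~ w∈)
        tot′ (inj₂ w∈)   (inj₂ w′∈)  = tot _ w∈ _ w′∈

  flag-f≡count : ∀ {n} → rank ≡ suc n → (S : Subset n) → ℤ.+ flag-f P S ≡ count 0 0̂ S
  flag-f≡count rank≡ S = trans (cong (ℤ.+_) (length-unique
      (Unique.filter⁺ (maximalChainIn? P S) (unique-subsets size)) (chains-unique S 0 0̂)
      (λ C∈ → chains-complete S (maximal⇒full rank≡ (proj₂ (∈-filter⁻ (maximalChainIn? P S) {xs = subsets size} C∈))))
      (λ C∈ → ∈-filter⁺ (maximalChainIn? P S) (∈-subsets _) (full⇒maximal rank≡ (chains-sound S C∈)))))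
    (length-chains S 0 0̂)

-- Walks and Laurent polynomials

open Pairing ℤ.+-0-monoid ℤ._≟_

sum-zero : ∀ (xs : List A) {f : A → ℤ} → (∀ x → x ∈ₗ xs → f x ≡ 0ℤ) → Sum xs f ≡ 0ℤ
sum-zero xs eq = trans (sum-cong-∈ xs eq) (sum-0 xs)

sum-single : ∀ {xs : List A} {f : A → ℤ} {x} → Unique xs → x ∈ₗ xs → (∀ y → y ≢ x → f y ≡ 0ℤ) → Sum xs f ≡ f x
sum-single {xs = x ∷ xs} {f} (x∉ ∷ _) (here refl) eq =
  trans (cong (f x +_) (sum-zero xs λ y y∈ → eq y λ { refl → All.lookup x∉ y∈ refl })) (ℤ.+-identityʳ (f x))
sum-single {xs = y ∷ xs} {f} {x} (y∉ ∷ u) (there x∈) eq =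
  trans (cong₂ _+_ (eq y λ { refl → All.lookup y∉ x∈ refl }) (sum-single u x∈ eq)) (ℤ.+-identityˡ (f x))

positive : ℤ → Bool
positive (ℤ.+ suc _) = true
positive _           = false

-- φ is read as the functional xʰ ↦ φ h, so that step and pos are dual to the
-- multiplication by x⁻¹ - x and to the projection to positive exponents.
step : (ℤ → ℤ) → ℤ → ℤ
step φ h = φ (ℤ.pred h) - φ (ℤ.suc h)

pos : (ℤ → ℤ) → ℤ → ℤ
pos φ h = when (positive h) (φ h)

-- Dual to `discardNegative`. Unlike `pos`, it keeps exponent 0.
truncate : (ℤ → ℤ) → ℤ → ℤ
truncate χ h = when (does (0ℤ ℤ.≤? h)) (χ h)

walk : ℕ → (ℤ → ℤ) → ℤ → ℤ
walk zero    φ = φ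
walk (suc l) φ = step (walk l φ)

step-cong : ∀ {φ ψ} → φ ≗ ψ → step φ ≗ step ψ
step-cong eq h = cong₂ _-_ (eq _) (eq _)

step-minus : ∀ φ ψ → step (λ h → φ h - ψ h) ≗ (λ h → step φ h - step ψ h)
step-minus φ ψ h = regroup (φ (ℤ.pred h)) (ψ (ℤ.pred h)) (φ (ℤ.suc h)) (ψ (ℤ.suc h))
  where
  regroup : ∀ x y u v → x - y - (u - v) ≡ x - u - (y - v)
  regroup = solve-∀

step-sum : ∀ (xs : List A) (φ : A → ℤ → ℤ) → step (λ h → Sum xs (λ x → φ x h)) ≗ (λ h → Sum xs (λ x → step (φ x) h))
step-sum xs φ h = sym (sum-minus xs _ _)

walk-cong : ∀ l {φ ψ} → φ ≗ ψ → walk l φ ≗ walk l ψ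
walk-cong zero    eq = eq
walk-cong (suc l) eq = step-cong (walk-cong l eq)

walk-step : ∀ l φ → walk l (step φ) ≗ step (walk l φ)
walk-step zero    φ h = refl
walk-step (suc l) φ = step-cong (walk-step l φ)

walk-minus : ∀ l φ ψ → walk l (λ h → φ h - ψ h) ≗ (λ h → walk l φ h - walk l ψ h)
walk-minus zero    φ ψ h = refl
walk-minus (suc l) φ ψ h = trans (step-cong (walk-minus l φ ψ) h) (step-minus (walk l φ) (walk l ψ) h)

walk-sum : ∀ l (xs : List A) (φ : A → ℤ → ℤ) → walk l (λ h → Sum xs (λ x → φ x h)) ≗ (λ h → Sum xs (λ x → walk l (φ x) h))
walk-sum zero    xs φ h = refl
walk-sum (suc l) xs φ h = trans (step-cong (walk-sum l xs φ) h) (step-sum xs (walk l ∘ φ) h)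

-- Σ_S (-1)^|S| f_S Σ_λ ± ψ(end of λ), where λ runs over the walks from h that
-- are positive at all times in S.
fine : ∀ m → (Vec Bool m → ℤ) → (ℤ → ℤ) → ℤ → ℤ
fine zero    f ψ h = f [] * ψ h
fine (suc m) f ψ   = step λ h → fine m (f ∘ (false ∷_)) ψ h - pos (fine m (f ∘ (true ∷_)) ψ) h

fine-cong : ∀ m {f g} ψ → f ≗ g → fine m f ψ ≗ fine m g ψ
fine-cong zero    ψ eq h = cong (_* ψ h) (eq [])
fine-cong (suc m) ψ eq   = step-cong λ h → cong₂ _-_ (fine-cong m ψ (eq ∘ (false ∷_)) h)
  (cong (when (positive h)) (fine-cong m ψ (eq ∘ (true ∷_)) h))

fine-sum : ∀ m (xs : List A) (f : A → Vec Bool m → ℤ) ψ →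
           fine m (λ S → Sum xs (λ x → f x S)) ψ ≗ (λ h → Sum xs (λ x → fine m (f x) ψ h))
fine-sum zero    xs f ψ h = trans (ℤ.*-comm _ (ψ h)) (trans (sym (sum-* xs (ψ h) (λ x → f x [])))
  (sum-cong xs λ x → ℤ.*-comm (ψ h) (f x [])))
fine-sum (suc m) xs f ψ h = trans (step-cong inner h) (step-sum xs (λ x h → fine m (f x ∘ (false ∷_)) ψ h - pos (fine m (f x ∘ (true ∷_)) ψ) h) h)
  where
  inner : (λ h → fine m (λ S → Sum xs (λ x → f x (false ∷ S))) ψ h
               - pos (fine m (λ S → Sum xs (λ x → f x (true ∷ S))) ψ) h)
          ≗ (λ h → Sum xs (λ x → fine m (f x ∘ (false ∷_)) ψ h - pos (fine m (f x ∘ (true ∷_)) ψ) h))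
  inner h = trans (cong₂ _-_ (fine-sum m xs _ ψ h)
      (trans (cong (when (positive h)) (fine-sum m xs _ ψ h)) (when-sum (positive h) xs _)))
    (sym (sum-minus xs _ _))

-- Zero is the empty sum, so additivity over lists already contains this case.
fine-zero : ∀ m ψ → fine m (λ _ → 0ℤ) ψ ≗ (λ _ → 0ℤ)
fine-zero m ψ = fine-sum {A = Bool} m [] (λ _ _ → 0ℤ) ψ

fine-when : ∀ m t f ψ → fine m (λ S → when t (f S)) ψ ≗ (λ h → when t (fine m f ψ h))
fine-when m true  f ψ h = refl
fine-when m false f ψ h = fine-zero m ψ h

-2ℤ : ℤ
-2ℤ = ℤ.- (ℤ.+ 2)

-- The left side is xʰ xˡ (x⁻² - 1)ˡ = xʰ (x⁻¹ - x)ˡ read as a functional. Each factor uses up one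
-- unit of `l`: its term x then moves down by one, and its term -1 moves up by one with a sign.
pair-[x-1]^ : ∀ l φ h → pair ((x^ 1ℤ ⊕ -1ℤ · 1#) ↑ l) (λ j → φ (h + ℤ.+ l + -2ℤ * j)) ≡ walk l φ h
pair-[x-1]^ zero    φ h = trans (pair-monomial 0ℤ {λ j → φ (h + 0ℤ + -2ℤ * j)}) (cong φ (trans (ℤ.+-identityʳ _) (ℤ.+-identityʳ h)))
pair-[x-1]^ (suc l) φ h = trans (pair-⊛ (x^ 1ℤ ⊕ -1ℤ · 1#) ((x^ 1ℤ ⊕ -1ℤ · 1#) ↑ l) {λ j → φ (h + ℤ.+ suc l + -2ℤ * j)})
  (trans (two-terms (λ i → pair ((x^ 1ℤ ⊕ -1ℤ · 1#) ↑ l) λ j → φ (h + ℤ.+ suc l + -2ℤ * (i + j))))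
    (cong₂ _-_ (trans (pair-cong ((x^ 1ℤ ⊕ -1ℤ · 1#) ↑ l) λ j → cong φ (down h (ℤ.+ l) j)) (pair-[x-1]^ l φ (ℤ.pred h)))
               (trans (pair-cong ((x^ 1ℤ ⊕ -1ℤ · 1#) ↑ l) λ j → cong φ (up h (ℤ.+ l) j)) (pair-[x-1]^ l φ (ℤ.suc h)))))
  where
  two-terms : ∀ χ → pair (x^ 1ℤ ⊕ -1ℤ · 1#) χ ≡ χ 1ℤ - χ 0ℤ
  two-terms χ = simplify (χ 1ℤ) (χ 0ℤ)
    where
    simplify : ∀ x y → 1ℤ * x + (-1ℤ * y + 0ℤ) ≡ x - y
    simplify = solve-∀
  down : ∀ h l j → h + (1ℤ + l) + -2ℤ * (1ℤ + j) ≡ -1ℤ + h + l + -2ℤ * j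
  down = solve-∀
  up : ∀ h l j → h + (1ℤ + l) + -2ℤ * (0ℤ + j) ≡ 1ℤ + h + l + -2ℤ * j
  up = solve-∀

-- `truncatedDifference` reads f from exponent 0 on, so its description as a truncated product would
-- miss terms of negative exponent. The condition is put on the terms rather than on the
-- coefficients because the ring operations preserve it term by term.
Nonnegative : Laurent → Set
Nonnegative = All λ (_ , i) → 0ℤ ℤ.≤ i

nonnegative-monomial : ∀ i → Nonnegative (x^ (ℤ.+ i))
nonnegative-monomial i = ℤ.+≤+ ℕ.z≤n ∷ []

nonnegative-· : ∀ k {p} → Nonnegative p → Nonnegative (k · p)
nonnegative-· k nn = All.map⁺ nn

nonnegative-⊛ : ∀ {p q} → Nonnegative p → Nonnegative q → Nonnegative (p ⊛ q)
nonnegative-⊛ []       nn′ = []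
nonnegative-⊛ (0≤i ∷ nn) nn′ =
  All.++⁺ (All.map⁺ (All.map (ℤ.+-mono-≤ 0≤i) nn′)) (nonnegative-⊛ nn nn′)

nonnegative-↑ : ∀ {p} k → Nonnegative p → Nonnegative (p ↑ k)
nonnegative-↑ zero    nn = nonnegative-monomial 0
nonnegative-↑ (suc k) nn = nonnegative-⊛ nn (nonnegative-↑ k nn)

nonnegative-sum : ∀ (xs : List A) (f : A → Laurent) → (∀ x → Nonnegative (f x)) → Nonnegative (sum xs f)
nonnegative-sum xs f nn = All.concat⁺ (All.map⁺ (All.universal nn xs))

pair-cong-nonnegative : ∀ {p φ ψ} → Nonnegative p → (∀ i → φ (ℤ.+ i) ≡ ψ (ℤ.+ i)) → pair p φ ≡ pair p ψ
pair-cong-nonnegative {p} nn eq = sum-cong-∈ p λ (k , i) i∈ → cong (k *_) (at i (All.lookup nn i∈))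
  where
  at : ∀ i → 0ℤ ℤ.≤ i → _
  at (ℤ.+ i) _ = eq i

sum-upTo-δ : ∀ N (χ : ℕ → ℤ) j → (N ℕ.≤ j → χ j ≡ 0ℤ) →
             Sum (upTo N) (λ i → when (does (j ℕ.≟ i)) (χ i)) ≡ χ j
sum-upTo-δ N χ j vanishes with j ℕ.<? N
... | yes j<N = trans
  (sum-single (Unique.upTo⁺ N) (∈-upTo⁺ j<N) λ i i≢j → when-no (j ℕ.≟ i) (i≢j ∘ sym))
  (when-yes (j ℕ.≟ j) refl)
... | no j≮N = trans
  (sum-zero (upTo N) λ i i∈ → when-no (j ℕ.≟ i) λ { refl → j≮N (∈-upTo⁻ i∈) })
  (sym (vanishes (ℕ.≮⇒≥ j≮N)))

-- Since `χ` vanishes from `N` on, the finite range loses no term of `p`. The shifts s = 0 and s = 1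
-- serve the two coefficients whose difference defines g.
sum-coeff-shift : ∀ {p} → Nonnegative p → ∀ N s (χ : ℤ → ℤ) → (∀ i → N ℕ.≤ i → χ (ℤ.+ i) ≡ 0ℤ) →
  Sum (upTo N) (λ i → coeff (ℤ.+ i - ℤ.+ s) p * χ (ℤ.+ i)) ≡ pair p (λ i → χ (i + ℤ.+ s))
sum-coeff-shift {p} nn N s χ vanishes = begin
  Sum (upTo N) (λ i → coeff (ℤ.+ i - ℤ.+ s) p * χ (ℤ.+ i))
    ≡⟨ sum-cong (upTo N) (λ i → trans (cong (_* χ (ℤ.+ i)) (coeff-pair (ℤ.+ i - ℤ.+ s) p))
         (trans (ℤ.*-comm _ (χ (ℤ.+ i))) (sym (pair-* p (χ (ℤ.+ i)) (δ (ℤ.+ i - ℤ.+ s)))))) ⟩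
  Sum (upTo N) (λ i → pair p (λ j → χ (ℤ.+ i) * δ (ℤ.+ i - ℤ.+ s) j))
    ≡⟨ pair-sumʳ p (upTo N) (λ i j → χ (ℤ.+ i) * δ (ℤ.+ i - ℤ.+ s) j) ⟨
  pair p (λ j → Sum (upTo N) (λ i → χ (ℤ.+ i) * δ (ℤ.+ i - ℤ.+ s) j))
    ≡⟨ pair-cong-nonnegative nn (λ j → trans (sum-cong (upTo N) (λ i → selects i j))
         (sum-upTo-δ N (χ ∘ ℤ.+_) (j ℕ.+ s) (vanishes (j ℕ.+ s)))) ⟩
  pair p (λ i → χ (i + ℤ.+ s)) ∎
  where
  move : ∀ x y → x - y + y ≡ x
  move = solve-∀
  move′ : ∀ x y → x + y - y ≡ x
  move′ = solve-∀
  selects : ∀ i j → χ (ℤ.+ i) * δ (ℤ.+ i - ℤ.+ s) (ℤ.+ j) ≡ when (does (j ℕ.+ s ℕ.≟ i)) (χ (ℤ.+ i))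
  selects i j = trans (sym (when-* (does (ℤ.+ j ℤ.≟ ℤ.+ i - ℤ.+ s)) (χ (ℤ.+ i)) 1ℤ))
    (when-cong (ℤ.+ j ℤ.≟ ℤ.+ i - ℤ.+ s) (j ℕ.+ s ℕ.≟ i)
      (λ eq → ℤ.+-injective (trans (cong (_+ ℤ.+ s) eq) (move (ℤ.+ i) (ℤ.+ s))))
      (λ { refl → sym (move′ (ℤ.+ j) (ℤ.+ s)) }) (λ _ → ℤ.*-identityʳ _))

double≤⇐≤⌊/2⌋ : ∀ k i → i ℕ.≤ ⌊ k /2⌋ → i ℕ.+ i ℕ.≤ k
double≤⇐≤⌊/2⌋ k             zero    _           = ℕ.z≤n
double≤⇐≤⌊/2⌋ (suc (suc k)) (suc i) (ℕ.s≤s i≤) =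
  ℕ.s≤s (subst (ℕ._≤ suc k) (sym (ℕ.+-suc i i)) (ℕ.s≤s (double≤⇐≤⌊/2⌋ k i i≤)))

<double⇐⌊/2⌋< : ∀ k i → ⌊ k /2⌋ ℕ.< i → k ℕ.< i ℕ.+ i
<double⇐⌊/2⌋< zero          (suc i) _           = ℕ.z<s
<double⇐⌊/2⌋< (suc zero)    (suc i) _           = ℕ.s≤s (subst (1 ℕ.≤_) (sym (ℕ.+-suc i i)) (ℕ.s≤s ℕ.z≤n))
<double⇐⌊/2⌋< (suc (suc k)) (suc i) (ℕ.s≤s <i) =
  ℕ.s≤s (subst (suc (suc k) ℕ.≤_) (sym (ℕ.+-suc i i)) (ℕ.s≤s (<double⇐⌊/2⌋< k i <i)))

-- The bound 2i ≤ k is the same as k + 1 - 2i > 0: the degrees kept in g at rank k + 1 are those of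
-- positive height.
positive-below-half : ∀ k i → i ℕ.≤ ⌊ k /2⌋ → positive (ℤ.+ suc k + -2ℤ * ℤ.+ i) ≡ true
positive-below-half k i i≤ with t , refl ← ℕ.m≤n⇒∃[o]m+o≡n (double≤⇐≤⌊/2⌋ k i i≤) =
  cong positive (cancel (ℤ.+ i) (ℤ.+ t))
  where
  cancel : ∀ x y → 1ℤ + (x + x + y) + -2ℤ * x ≡ 1ℤ + y
  cancel = solve-∀

nonpositive-above-half : ∀ k i → ⌊ k /2⌋ ℕ.< i → positive (ℤ.+ suc k + -2ℤ * ℤ.+ i) ≡ false
nonpositive-above-half k i <i with t , eq ← ℕ.m≤n⇒∃[o]m+o≡n (<double⇐⌊/2⌋< k i <i) =
  trans (cong positive (trans (double (ℤ.+ suc k) (ℤ.+ i))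
    (trans (cong (λ m → ℤ.+ suc k - ℤ.+ m) (sym eq)) (cancel (ℤ.+ suc k) (ℤ.+ t))))) (neg t)
  where
  double : ∀ k x → k + -2ℤ * x ≡ k - (x + x)
  double = solve-∀
  cancel : ∀ x y → x - (x + y) ≡ - y
  cancel = solve-∀
  neg : ∀ t → positive (- (ℤ.+ t)) ≡ false
  neg zero    = refl
  neg (suc _) = refl

-- The truncation in g keeps the positive exponents of (x - x⁻¹) xᵏ f(x⁻²).
pair-truncatedDifference : ∀ k {f} φ → Nonnegative f →
  pair (truncatedDifference k f) (λ i → φ (ℤ.+ suc k + -2ℤ * i))
  ≡ - pair f (λ i → step (pos φ) (ℤ.+ k + -2ℤ * i))
pair-truncatedDifference k {f} φ nn = begin
  pair (truncatedDifference k f) φ′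
    ≡⟨ pair-sumˡ (upTo N) (λ i → (coeff (ℤ.+ i) f - coeff (ℤ.+ i - 1ℤ) f) · x^ (ℤ.+ i)) {φ′} ⟩
  Sum (upTo N) (λ i → pair ((coeff (ℤ.+ i) f - coeff (ℤ.+ i - 1ℤ) f) · x^ (ℤ.+ i)) φ′)
    ≡⟨ sum-cong-∈ (upTo N) (λ i i∈ → term i (ℕ.s≤s⁻¹ (∈-upTo⁻ i∈))) ⟩
  Sum (upTo N) (λ i → coeff (ℤ.+ i - 0ℤ) f * χ (ℤ.+ i) - coeff (ℤ.+ i - 1ℤ) f * χ (ℤ.+ i))
    ≡⟨ sum-minus (upTo N) (λ i → coeff (ℤ.+ i - 0ℤ) f * χ (ℤ.+ i)) (λ i → coeff (ℤ.+ i - 1ℤ) f * χ (ℤ.+ i)) ⟩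
  Sum (upTo N) (λ i → coeff (ℤ.+ i - 0ℤ) f * χ (ℤ.+ i)) - Sum (upTo N) (λ i → coeff (ℤ.+ i - 1ℤ) f * χ (ℤ.+ i))
    ≡⟨ cong₂ _-_ (sum-coeff-shift nn N 0 χ vanishes) (sum-coeff-shift nn N 1 χ vanishes) ⟩
  pair f (λ i → χ (i + 0ℤ)) - pair f (λ i → χ (i + 1ℤ))
    ≡⟨ negate (pair f (λ i → χ (i + 0ℤ))) (pair f (λ i → χ (i + 1ℤ))) ⟩
  - (pair f (λ i → χ (i + 1ℤ)) - pair f (λ i → χ (i + 0ℤ)))
    ≡⟨ cong -_ (pair-minus f (λ i → χ (i + 1ℤ)) (λ i → χ (i + 0ℤ))) ⟨
  - pair f (λ i → χ (i + 1ℤ) - χ (i + 0ℤ))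
    ≡⟨ cong -_ (pair-cong f (λ i → cong₂ _-_ (cong (pos φ) (down (ℤ.+ k) i)) (cong (pos φ) (up (ℤ.+ k) i)))) ⟩
  - pair f (λ i → step (pos φ) (ℤ.+ k + -2ℤ * i)) ∎
  where
  N = suc ⌊ k /2⌋
  φ′ = λ i → φ (ℤ.+ suc k + -2ℤ * i)
  χ  = λ i → pos φ (ℤ.+ suc k + -2ℤ * i)

  down : ∀ k i → 1ℤ + k + -2ℤ * (i + 1ℤ) ≡ -1ℤ + (k + -2ℤ * i)
  down = solve-∀
  up : ∀ k i → 1ℤ + k + -2ℤ * (i + 0ℤ) ≡ 1ℤ + (k + -2ℤ * i)
  up = solve-∀
  negate : ∀ x y → x - y ≡ - (y - x)
  negate = solve-∀
  distrib : ∀ x y z → (x - y) * z ≡ x * z - y * z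
  distrib = solve-∀

  vanishes : ∀ i → N ℕ.≤ i → χ (ℤ.+ i) ≡ 0ℤ
  vanishes i N≤i = cong (λ t → when t (φ′ (ℤ.+ i))) (nonpositive-above-half k i N≤i)

  term : ∀ i → i ℕ.≤ ⌊ k /2⌋ → pair ((coeff (ℤ.+ i) f - coeff (ℤ.+ i - 1ℤ) f) · x^ (ℤ.+ i)) φ′
         ≡ coeff (ℤ.+ i - 0ℤ) f * χ (ℤ.+ i) - coeff (ℤ.+ i - 1ℤ) f * χ (ℤ.+ i)
  term i i≤ = begin
    pair ((F₀ - F₁) · x^ (ℤ.+ i)) φ′   ≡⟨ pair-· (F₀ - F₁) (x^ (ℤ.+ i)) {φ′} ⟩
    (F₀ - F₁) * pair (x^ (ℤ.+ i)) φ′   ≡⟨ cong ((F₀ - F₁) *_) (pair-monomial (ℤ.+ i) {φ′}) ⟩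
    (F₀ - F₁) * φ′ (ℤ.+ i)
      -- Within the range the height is positive, so the projection contained in `χ` costs nothing
      -- here; afterwards it replaces the upper limit of the sum.
      ≡⟨ cong (λ t → (F₀ - F₁) * when t (φ′ (ℤ.+ i))) (positive-below-half k i i≤) ⟨
    (F₀ - F₁) * χ (ℤ.+ i)              ≡⟨ distrib F₀ F₁ (χ (ℤ.+ i)) ⟩
    F₀ * χ (ℤ.+ i) - F₁ * χ (ℤ.+ i)    ≡⟨ cong (λ j → coeff j f * χ (ℤ.+ i) - F₁ * χ (ℤ.+ i)) (ℤ.+-identityʳ (ℤ.+ i)) ⟨
    coeff (ℤ.+ i - 0ℤ) f * χ (ℤ.+ i) - F₁ * χ (ℤ.+ i) ∎
    where
    F₀ = coeff (ℤ.+ i) f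
    F₁ = coeff (ℤ.+ i - 1ℤ) f

-- The toric polynomial

byRank-cong : ∀ r {h h′ : ℕ → Laurent} → h ≗ h′ → byRank r h ≡ byRank r h′
byRank-cong zero    eq = refl
byRank-cong (suc n) eq = eq n

byRank-zero : ∀ {r h} → r ≡ 0 → byRank r h ≡ 1#
byRank-zero refl = refl

byRank-suc : ∀ {r n h} → r ≡ suc n → byRank r h ≡ h n
byRank-suc refl = refl

nonnegative-byRank : ∀ r {h} → (∀ n → Nonnegative (h n)) → Nonnegative (byRank r h)
nonnegative-byRank zero    nn = nonnegative-monomial 0
nonnegative-byRank (suc n) nn = nn n

nonnegative-truncatedDifference : ∀ n f → Nonnegative (truncatedDifference n f)
nonnegative-truncatedDifference n f = nonnegative-sum (upTo (suc ⌊ n /2⌋)) _ λ i →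
  nonnegative-· (coeff (ℤ.+ i) f ℤ.- coeff (ℤ.+ i ℤ.- 1ℤ) f) (nonnegative-monomial i)

module ToricProperties (P : GradedPoset) where
  open GradedPoset P
  open GradedPosetProperties P

  -- The recursion reaches `q` with an accessibility proof derived from that of `p`, whereas
  -- `toric-g` takes the canonical one. Only with this independence can the unfolded terms be named
  -- by `toric-g`.
  toric-f-irrelevant : ∀ {p} (ac ac′ : Acc _<_ p) → toric-f-acc P p ac ≡ toric-f-acc P p ac′
  toric-term-irrelevant : ∀ {p} n (ac ac′ : Acc _<_ p) q (q<?p : Dec (q < p)) →
                          toric-term P n ac q q<?p ≡ toric-term P n ac′ q q<?p
  toric-g-irrelevant : ∀ {p} (ac ac′ : Acc _<_ p) → toric-g-acc P p ac ≡ toric-g-acc P p ac′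

  toric-f-irrelevant {p} ac ac′ = byRank-cong (ρ p) λ n →
    concatMap-cong (λ q → toric-term-irrelevant n ac ac′ q (q <? p)) elements
  toric-term-irrelevant n (acc rs) (acc rs′) q (yes q<p) =
    cong (_⊛ (x^ 1ℤ ⊕ -1ℤ · 1#) ↑ (n ℕ.∸ ρ q)) (toric-g-irrelevant (rs q<p) (rs′ q<p))
  toric-term-irrelevant n (acc rs) (acc rs′) q (no _) = refl
  toric-g-irrelevant {p} ac ac′ = byRank-cong (ρ p) λ n →
    cong (truncatedDifference n) (toric-f-irrelevant ac ac′)

  nonnegative-toric-g : ∀ p (ac : Acc _<_ p) → Nonnegative (toric-g-acc P p ac)
  nonnegative-toric-g p ac = nonnegative-byRank (ρ p) λ n →
    nonnegative-truncatedDifference n (toric-f-acc P p ac)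

  nonnegative-toric-f : ∀ p → Nonnegative (toric-f P p)
  nonnegative-toric-f p = nonnegative-byRank (ρ p) λ n → nonnegative-sum elements _ λ q →
    term n (<-wellFounded P p) q (q <? p)
    where
    term : ∀ n (ac : Acc _<_ p) q (q<?p : Dec (q < p)) → Nonnegative (toric-term P n ac q q<?p)
    term n (acc rs) q (yes q<p) = nonnegative-⊛ (nonnegative-toric-g q (rs q<p))
      (nonnegative-↑ (n ℕ.∸ ρ q) (All.++⁺ (nonnegative-monomial 1) (nonnegative-· -1ℤ (nonnegative-monomial 0))))
    term n (acc rs) q (no _)    = []

  -- The functional of the Laurent polynomial x^ρ(q) g([0̂,q),x⁻²)
  Γ : Fin size → (ℤ → ℤ) → ℤ
  Γ q φ = pair (toric-g P q) λ i → φ (ℤ.+ ρ q + -2ℤ * i)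

  Γ-cong : ∀ q {φ ψ} → φ ≗ ψ → Γ q φ ≡ Γ q ψ
  Γ-cong q eq = pair-cong (toric-g P q) λ i → eq _

  Γ-minus : ∀ q φ ψ → Γ q (λ h → φ h - ψ h) ≡ Γ q φ - Γ q ψ
  Γ-minus q φ ψ = pair-minus (toric-g P q) (λ i → φ (ℤ.+ ρ q + -2ℤ * i)) (λ i → ψ (ℤ.+ ρ q + -2ℤ * i))

  Γ-sum : ∀ q (xs : List A) (φ : A → ℤ → ℤ) → Γ q (λ h → Sum xs (λ x → φ x h)) ≡ Sum xs (λ x → Γ q (φ x))
  Γ-sum q xs φ = pair-sumʳ (toric-g P q) xs (λ x i → φ x (ℤ.+ ρ q + -2ℤ * i))

  Γ-0̂ : ∀ φ → Γ 0̂ φ ≡ φ 0ℤ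
  Γ-0̂ φ = begin
    Γ 0̂ φ                                ≡⟨ cong (λ g → pair g φ′) (byRank-zero ρ-0̂) ⟩
    pair 1# φ′                            ≡⟨ pair-monomial 0ℤ {φ′} ⟩
    φ (ℤ.+ ρ 0̂ + 0ℤ)                     ≡⟨ cong (λ r → φ (ℤ.+ r + 0ℤ)) ρ-0̂ ⟩
    φ 0ℤ                                  ∎
    where φ′ = λ i → φ (ℤ.+ ρ 0̂ + -2ℤ * i)

  -- The scaling xⁿ splits as x^ρ(q), absorbed by g of `q`, and xˡ with l = n - ρ(q), absorbed by (x
  -- - 1)ˡ. So `q` contributes its state at time ρ(q) followed by free steps up to time n.
  pair-toric-f : ∀ {p n} → ρ p ≡ suc n → ∀ φ → pair (toric-f P p) (λ i → φ (ℤ.+ n + -2ℤ * i))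
                 ≡ Sum elements (λ q → when (does (q <? p)) (Γ q (walk (n ℕ.∸ ρ q) φ)))
  pair-toric-f {p} {n} ρp φ = begin
    pair (toric-f P p) φ′
      ≡⟨ cong (λ f → pair f φ′) (byRank-suc ρp) ⟩
    pair (sum elements (λ q → toric-term P n (<-wellFounded P p) q (q <? p))) φ′
      ≡⟨ pair-sumˡ elements (λ q → toric-term P n (<-wellFounded P p) q (q <? p)) {φ′} ⟩
    Sum elements (λ q → pair (toric-term P n (<-wellFounded P p) q (q <? p)) φ′)
      ≡⟨ sum-cong elements (λ q → term (<-wellFounded P p) q (q <? p)) ⟩
    Sum elements (λ q → when (does (q <? p)) (Γ q (walk (n ℕ.∸ ρ q) φ))) ∎
    where
    φ′ = λ i → φ (ℤ.+ n + -2ℤ * i)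

    exponents : ∀ r l i j → r + l + -2ℤ * (i + j) ≡ r + -2ℤ * i + l + -2ℤ * j
    exponents = solve-∀

    term : ∀ (ac : Acc _<_ p) q (q<?p : Dec (q < p)) → pair (toric-term P n ac q q<?p) φ′
           ≡ when (does q<?p) (Γ q (walk (n ℕ.∸ ρ q) φ))
    term (acc rs) q (no _)    = refl
    term (acc rs) q (yes q<p) = begin
      pair (toric-g-acc P q (rs q<p) ⊛ x-1↑l) φ′
        ≡⟨ cong (λ g → pair (g ⊛ x-1↑l) φ′) (toric-g-irrelevant (rs q<p) (<-wellFounded P q)) ⟩
      pair (toric-g P q ⊛ x-1↑l) φ′
        ≡⟨ pair-⊛ (toric-g P q) x-1↑l {φ′} ⟩
      pair (toric-g P q) (λ i → pair x-1↑l (λ j → φ (ℤ.+ n + -2ℤ * (i + j))))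
        ≡⟨ pair-cong (toric-g P q) (λ i → trans
             (pair-cong x-1↑l λ j → cong φ (trans (cong (λ m → ℤ.+ m + -2ℤ * (i + j)) (sym ρq+l≡n))
               (exponents (ℤ.+ ρ q) (ℤ.+ l) i j)))
             (pair-[x-1]^ l φ (ℤ.+ ρ q + -2ℤ * i))) ⟩
      Γ q (walk l φ) ∎
      where
      l = n ℕ.∸ ρ q
      x-1↑l = (x^ 1ℤ ⊕ -1ℤ · 1#) ↑ l
      ρq+l≡n : ρ q ℕ.+ l ≡ n
      ρq+l≡n = ℕ.m+[n∸m]≡n (ℕ.s≤s⁻¹ (subst (ρ q ℕ.<_) ρp (ρ-mono-< q<p)))

  -- Passing from f to g adds one step, from time k to time k + 1 = ρ(p), and keeps the walks that
  -- are then positive. The minus sign is the one that each chain element contributes to (-1)^|S|.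
  Γ-recursive : ∀ {p k} → ρ p ≡ suc k → ∀ φ →
    Γ p φ ≡ - Sum elements (λ q → when (does (q <? p)) (Γ q (walk (k ℕ.∸ ρ q) (step (pos φ)))))
  Γ-recursive {p} {k} ρp φ = begin
    Γ p φ
      ≡⟨ cong₂ (λ g r → pair g (λ i → φ (ℤ.+ r + -2ℤ * i))) (byRank-suc ρp) ρp ⟩
    pair (truncatedDifference k (toric-f P p)) (λ i → φ (ℤ.+ suc k + -2ℤ * i))
      ≡⟨ pair-truncatedDifference k φ (nonnegative-toric-f p) ⟩
    - pair (toric-f P p) (λ i → step (pos φ) (ℤ.+ k + -2ℤ * i))
      ≡⟨ cong -_ (pair-toric-f ρp (step (pos φ))) ⟩
    - Sum elements (λ q → when (does (q <? p)) (Γ q (walk (k ℕ.∸ ρ q) (step (pos φ))))) ∎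

  -- The state of the walks at height k, at time k, paired with the walks from
  -- there on: independent of k.
  hybrid : ∀ k m → (ℤ → ℤ) → ℤ
  hybrid k m ψ =
    Sum elements λ q → when (does (ρ q ℕ.≤? k)) (Γ q (walk (k ℕ.∸ ρ q) (fine m (count k q) ψ)))

  -- One step of `fine` either skips rank k + 1 or selects an element there. Skipping lengthens the
  -- free walk of each `q` of rank at most k. Selecting a given `q′` of rank k + 1, summed over all
  -- `q` below it, is the right side of `Γ-recursive` for `q′`, hence the new term of `q′`.
  hybrid-suc : ∀ k m ψ → hybrid k (suc m) ψ ≡ hybrid (suc k) m ψ
  hybrid-suc k m ψ = begin
    hybrid k (suc m) ψ
      ≡⟨ sum-cong elements (λ q → trans (cong (when (≤k q)) (expand q)) (when-minus (≤k q) _ _)) ⟩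
    Sum elements (λ q → when (≤k q) (Γ q (walk (suc (k ℕ.∸ ρ q)) (F q)))
                      - when (≤k q) (Sum elements (λ q′ → when (below q q′) (G q q′))))
      ≡⟨ sum-minus elements (λ q → when (≤k q) (Γ q (walk (suc (k ℕ.∸ ρ q)) (F q)))) _ ⟩
    Sum elements (λ q → when (≤k q) (Γ q (walk (suc (k ℕ.∸ ρ q)) (F q))))
    - Sum elements (λ q → when (≤k q) (Sum elements (λ q′ → when (below q q′) (G q q′))))
      -- The exchange makes the newly selected element the outer index, so that the two sides can be
      -- compared element by element according to its rank.
      ≡⟨ cong (λ z → Sum elements (λ q → when (≤k q) (Γ q (walk (suc (k ℕ.∸ ρ q)) (F q)))) - z)
           (trans (sum-cong elements (λ q → when-sum (≤k q) elements (λ q′ → when (below q q′) (G q q′))))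
             (sum-swap elements elements (λ q q′ → when (≤k q) (when (below q q′) (G q q′))))) ⟩
    Sum elements (λ q → when (≤k q) (Γ q (walk (suc (k ℕ.∸ ρ q)) (F q))))
    - Sum elements (λ q′ → Sum elements (λ q → when (≤k q) (when (below q q′) (G q q′))))
      ≡⟨ sum-minus elements (λ q → when (≤k q) (Γ q (walk (suc (k ℕ.∸ ρ q)) (F q)))) _ ⟨
    Sum elements (λ q → when (≤k q) (Γ q (walk (suc (k ℕ.∸ ρ q)) (F q)))
                      - Sum elements (λ q′ → when (≤k q′) (when (below q′ q) (G q′ q))))
      ≡⟨ sum-cong elements merge ⟩
    hybrid (suc k) m ψ ∎
    where
    ≤k : Fin size → Bool
    ≤k q = does (ρ q ℕ.≤? k)

    below : Fin size → Fin size → Bool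
    below q q′ = does ((q <? q′) ×-dec (ρ q′ ℕ.≟ suc k))

    F : Fin size → ℤ → ℤ
    F q = fine m (count (suc k) q) ψ

    G : Fin size → Fin size → ℤ
    G q q′ = Γ q (walk (suc (k ℕ.∸ ρ q)) (pos (F q′)))

    not-below : ∀ {q q′} → ρ q′ ≢ suc k → when (below q q′) (G q q′) ≡ 0ℤ
    not-below {q} {q′} ρq′≢ = when-no ((q <? q′) ×-dec (ρ q′ ℕ.≟ suc k)) (ρq′≢ ∘ proj₂)

    fine-above : ∀ q h → pos (fine m (count k q ∘ (true ∷_)) ψ) h
                       ≡ Sum elements (λ q′ → when (below q q′) (pos (F q′) h))
    fine-above q h = begin
      pos (fine m (count k q ∘ (true ∷_)) ψ) h
        ≡⟨ cong (when (positive h)) (fine-sum m elements (λ q′ S → when (below q q′) (count (suc k) q′ S)) ψ h) ⟩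
      when (positive h) (Sum elements (λ q′ → fine m (λ S → when (below q q′) (count (suc k) q′ S)) ψ h))
        ≡⟨ when-sum (positive h) elements _ ⟩
      Sum elements (λ q′ → when (positive h) (fine m (λ S → when (below q q′) (count (suc k) q′ S)) ψ h))
        ≡⟨ sum-cong elements (λ q′ → trans
             (cong (when (positive h)) (fine-when m (below q q′) (count (suc k) q′) ψ h))
             (when-comm (positive h) (below q q′) (F q′ h))) ⟩
      Sum elements (λ q′ → when (below q q′) (pos (F q′) h)) ∎

    Γ-walk-when : ∀ q l t φ → Γ q (walk l (λ h → when t (φ h))) ≡ when t (Γ q (walk l φ))
    Γ-walk-when q l true  φ = refl
    Γ-walk-when q l false φ = trans (Γ-cong q (walk-sum {A = Bool} l [] (λ _ _ → 0ℤ)))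
      (Γ-sum {A = Bool} q [] (λ _ _ → 0ℤ))

    expand : ∀ q → Γ q (walk (k ℕ.∸ ρ q) (fine (suc m) (count k q) ψ))
           ≡ Γ q (walk (suc (k ℕ.∸ ρ q)) (F q)) - Sum elements (λ q′ → when (below q q′) (G q q′))
    expand q = begin
      Γ q (walk l (fine (suc m) (count k q) ψ))
        ≡⟨ Γ-cong q (walk-cong l (step-cong (λ h → cong (λ z → F q h - z) (fine-above q h)))) ⟩
      Γ q (walk l (step (λ h → F q h - Sum elements (λ q′ → when (below q q′) (pos (F q′) h)))))
        ≡⟨ Γ-cong q (λ h → walk-step l (λ h → F q h - Sum elements (λ q′ → when (below q q′) (pos (F q′) h))) h) ⟩
      Γ q (walk (suc l) (λ h → F q h - Sum elements (λ q′ → when (below q q′) (pos (F q′) h))))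
        ≡⟨ Γ-cong q (walk-minus (suc l) (F q) (λ h → Sum elements (λ q′ → when (below q q′) (pos (F q′) h)))) ⟩
      Γ q (λ h → walk (suc l) (F q) h - walk (suc l) (λ h → Sum elements (λ q′ → when (below q q′) (pos (F q′) h))) h)
        ≡⟨ Γ-minus q (walk (suc l) (F q)) (walk (suc l) (λ h → Sum elements (λ q′ → when (below q q′) (pos (F q′) h)))) ⟩
      Γ q (walk (suc l) (F q)) - Γ q (walk (suc l) (λ h → Sum elements (λ q′ → when (below q q′) (pos (F q′) h))))
        ≡⟨ cong (λ z → Γ q (walk (suc l) (F q)) - z) (begin
          Γ q (walk (suc l) (λ h → Sum elements (λ q′ → when (below q q′) (pos (F q′) h))))
            ≡⟨ Γ-cong q (walk-sum (suc l) elements (λ q′ h → when (below q q′) (pos (F q′) h))) ⟩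
          Γ q (λ h → Sum elements (λ q′ → walk (suc l) (λ h → when (below q q′) (pos (F q′) h)) h))
            ≡⟨ Γ-sum q elements (λ q′ → walk (suc l) (λ h → when (below q q′) (pos (F q′) h))) ⟩
          Sum elements (λ q′ → Γ q (walk (suc l) (λ h → when (below q q′) (pos (F q′) h))))
            ≡⟨ sum-cong elements (λ q′ → Γ-walk-when q (suc l) (below q q′) (pos (F q′))) ⟩
          Sum elements (λ q′ → when (below q q′) (G q q′)) ∎) ⟩
      Γ q (walk (suc l) (F q)) - Sum elements (λ q′ → when (below q q′) (G q q′)) ∎
      where l = k ℕ.∸ ρ q

    merge : ∀ q → when (≤k q) (Γ q (walk (suc (k ℕ.∸ ρ q)) (F q)))
                  - Sum elements (λ q′ → when (≤k q′) (when (below q′ q) (G q′ q)))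
                ≡ when (does (ρ q ℕ.≤? suc k)) (Γ q (walk (suc k ℕ.∸ ρ q) (F q)))
    merge q with ℕ.<-cmp (ρ q) (suc k)
    ... | tri< ρq<1+k ρq≢1+k _ = begin
      when (≤k q) (Γ q (walk (suc (k ℕ.∸ ρ q)) (F q))) - Sum elements (λ q′ → when (≤k q′) (when (below q′ q) (G q′ q)))
        ≡⟨ cong₂ _-_ (when-yes (ρ q ℕ.≤? k) ρq≤k)
             (sum-zero elements (λ q′ _ → trans (cong (when (≤k q′)) (not-below {q′} {q} ρq≢1+k)) (when-0 (≤k q′)))) ⟩
      Γ q (walk (suc (k ℕ.∸ ρ q)) (F q)) - 0ℤ
        ≡⟨ ℤ.+-identityʳ _ ⟩
      Γ q (walk (suc (k ℕ.∸ ρ q)) (F q))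
        ≡⟨ cong (λ l → Γ q (walk l (F q))) (ℕ.+-∸-assoc 1 ρq≤k) ⟨
      Γ q (walk (suc k ℕ.∸ ρ q) (F q))
        ≡⟨ when-yes (ρ q ℕ.≤? suc k) (ℕ.<⇒≤ ρq<1+k) ⟨
      when (does (ρ q ℕ.≤? suc k)) (Γ q (walk (suc k ℕ.∸ ρ q) (F q))) ∎
      where ρq≤k = ℕ.s≤s⁻¹ ρq<1+k
    ... | tri≈ _ ρq≡1+k _ = begin
      when (≤k q) (Γ q (walk (suc (k ℕ.∸ ρ q)) (F q))) - Sum elements (λ q′ → when (≤k q′) (when (below q′ q) (G q′ q)))
        ≡⟨ cong₂ _-_ (when-no (ρ q ℕ.≤? k) (ℕ.<⇒≱ (ℕ.≤-reflexive (sym ρq≡1+k)))) (sum-cong elements below-q) ⟩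
      0ℤ - Sum elements (λ q′ → when (does (q′ <? q)) (Γ q′ (walk (k ℕ.∸ ρ q′) (step (pos (F q))))))
        ≡⟨ ℤ.+-identityˡ _ ⟩
      - Sum elements (λ q′ → when (does (q′ <? q)) (Γ q′ (walk (k ℕ.∸ ρ q′) (step (pos (F q))))))
        ≡⟨ Γ-recursive ρq≡1+k (F q) ⟨
      Γ q (F q)
        ≡⟨ cong (λ l → Γ q (walk l (F q))) (trans (cong (suc k ℕ.∸_) ρq≡1+k) (ℕ.n∸n≡0 (suc k))) ⟨
      Γ q (walk (suc k ℕ.∸ ρ q) (F q))
        ≡⟨ when-yes (ρ q ℕ.≤? suc k) (ℕ.≤-reflexive ρq≡1+k) ⟨
      when (does (ρ q ℕ.≤? suc k)) (Γ q (walk (suc k ℕ.∸ ρ q) (F q))) ∎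
      where
      below-q : ∀ q′ → when (≤k q′) (when (below q′ q) (G q′ q))
                     ≡ when (does (q′ <? q)) (Γ q′ (walk (k ℕ.∸ ρ q′) (step (pos (F q)))))
      below-q q′ = by-cases (q′ <? q)
        where
        by-cases : Dec (q′ < q) → _
        by-cases (yes q′<q) = trans
          (when-yes (ρ q′ ℕ.≤? k) (ℕ.s≤s⁻¹ (subst (ρ q′ ℕ.<_) ρq≡1+k (ρ-mono-< q′<q))))
          (trans (when-yes ((q′ <? q) ×-dec (ρ q ℕ.≟ suc k)) (q′<q , ρq≡1+k))
            (trans (Γ-cong q′ λ h → sym (walk-step (k ℕ.∸ ρ q′) (pos (F q)) h))
              (sym (when-yes (q′ <? q) q′<q))))
        by-cases (no q′≮q) = trans
          (cong (when (≤k q′)) (when-no ((q′ <? q) ×-dec (ρ q ℕ.≟ suc k)) (q′≮q ∘ proj₁)))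
          (trans (when-0 (≤k q′)) (sym (when-no (q′ <? q) q′≮q)))
    ... | tri> _ ρq≢1+k 1+k<ρq = begin
      when (≤k q) (Γ q (walk (suc (k ℕ.∸ ρ q)) (F q))) - Sum elements (λ q′ → when (≤k q′) (when (below q′ q) (G q′ q)))
        ≡⟨ cong₂ _-_ (when-no (ρ q ℕ.≤? k) (ℕ.<⇒≱ (ℕ.<-trans (ℕ.n<1+n k) 1+k<ρq)))
             (sum-zero elements (λ q′ _ → trans (cong (when (≤k q′)) (not-below {q′} {q} ρq≢1+k)) (when-0 (≤k q′)))) ⟩
      0ℤ
        ≡⟨ when-no (ρ q ℕ.≤? suc k) (ℕ.<⇒≱ 1+k<ρq) ⟨
      when (does (ρ q ℕ.≤? suc k)) (Γ q (walk (suc k ℕ.∸ ρ q) (F q))) ∎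

  hybrid-invariant : ∀ k m ψ → hybrid k m ψ ≡ hybrid (k ℕ.+ m) 0 ψ
  hybrid-invariant k zero    ψ = cong (λ n → hybrid n 0 ψ) (sym (ℕ.+-identityʳ k))
  hybrid-invariant k (suc m) ψ = trans (hybrid-suc k m ψ)
    (trans (hybrid-invariant (suc k) m ψ) (cong (λ n → hybrid n 0 ψ) (sym (ℕ.+-suc k m))))

  hybrid-start : ∀ m ψ → hybrid 0 m ψ ≡ fine m (count 0 0̂) ψ 0ℤ
  hybrid-start m ψ = begin
    hybrid 0 m ψ
      ≡⟨ sum-single (Unique.allFin⁺ size) (∈-allFin 0̂) (λ q q≢0̂ →
           when-no (ρ q ℕ.≤? 0) (λ ρq≤0 → q≢0̂ (ρ≡0⇒≡0̂ (ℕ.n≤0⇒n≡0 ρq≤0)))) ⟩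
    when (does (ρ 0̂ ℕ.≤? 0)) (Γ 0̂ (walk (0 ℕ.∸ ρ 0̂) (fine m (count 0 0̂) ψ)))
      ≡⟨ when-yes (ρ 0̂ ℕ.≤? 0) (ℕ.≤-reflexive ρ-0̂) ⟩
    Γ 0̂ (walk (0 ℕ.∸ ρ 0̂) (fine m (count 0 0̂) ψ))
      ≡⟨ cong (λ l → Γ 0̂ (walk l (fine m (count 0 0̂) ψ))) (ℕ.0∸n≡0 (ρ 0̂)) ⟩
    Γ 0̂ (fine m (count 0 0̂) ψ)
      ≡⟨ Γ-0̂ (fine m (count 0 0̂) ψ) ⟩
    fine m (count 0 0̂) ψ 0ℤ ∎

  -- When no rank is left to choose, only free walks remain, and ρ(q) ≤ n singles out the elements
  -- below `1̂`: this is the sum that defines f.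
  hybrid-end : ∀ {n} → rank ≡ suc n → ∀ ψ → hybrid n 0 ψ ≡ pair (toric-f P 1̂) (λ i → ψ (ℤ.+ n + -2ℤ * i))
  hybrid-end {n} rank≡ ψ = begin
    hybrid n 0 ψ
      ≡⟨ sum-cong elements (λ q → when-cong (ρ q ℕ.≤? n) (q <? 1̂)
           (λ ρq≤n → comparable∧ρ<⇒< (inj₁ (maximum q)) (subst (ρ q ℕ.<_) (sym rank≡) (ℕ.s≤s ρq≤n)))
           (λ q<1̂ → ℕ.s≤s⁻¹ (subst (ρ q ℕ.<_) rank≡ (ρ-mono-< q<1̂)))
           (λ _ → Γ-cong q (walk-cong (n ℕ.∸ ρ q) (λ h → ℤ.*-identityˡ (ψ h))))) ⟩
    Sum elements (λ q → when (does (q <? 1̂)) (Γ q (walk (n ℕ.∸ ρ q) ψ)))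
      ≡⟨ pair-toric-f rank≡ ψ ⟨
    pair (toric-f P 1̂) (λ i → ψ (ℤ.+ n + -2ℤ * i)) ∎

  -- Fine's formula for the toric polynomial
  pair-toric-f≡fine : ∀ {n} → rank ≡ suc n → ∀ ψ →
    pair (toric-f P 1̂) (λ i → ψ (ℤ.+ n + -2ℤ * i)) ≡ fine n (λ S → ℤ.+ flag-f P S) ψ 0ℤ
  pair-toric-f≡fine {n} rank≡ ψ = begin
    pair (toric-f P 1̂) (λ i → ψ (ℤ.+ n + -2ℤ * i)) ≡⟨ hybrid-end rank≡ ψ ⟨
    hybrid n 0 ψ                                      ≡⟨ hybrid-invariant 0 n ψ ⟨
    hybrid 0 n ψ                                      ≡⟨ hybrid-start n ψ ⟩
    fine n (count 0 0̂) ψ 0ℤ                          ≡⟨ fine-cong n ψ (flag-f≡count rank≡) 0ℤ ⟨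
    fine n (λ S → ℤ.+ flag-f P S) ψ 0ℤ               ∎

  coeff-shortToric : ∀ {n} → rank ≡ suc n → ∀ m →
    coeff m (shortToric P n) ≡ fine n (λ S → ℤ.+ flag-f P S) (truncate (δ m)) 0ℤ
  coeff-shortToric {n} rank≡ m = begin
    coeff m (shortToric P n)
      ≡⟨ coeff-pair m (shortToric P n) ⟩
    pair (discardNegative p) (δ m)
      ≡⟨ trans (sum-filter (λ (_ , i) → 0ℤ ℤ.≤? i) p)
           (sum-cong p λ (k , i) → when-* (does (0ℤ ℤ.≤? i)) k (δ m i)) ⟩
    pair p ψ
      ≡⟨ trans (pair-⊛ (x^ (ℤ.+ n)) (substitute-x^ -2ℤ (toric-f P 1̂)) {ψ})
           (pair-monomial (ℤ.+ n) {λ i → pair (substitute-x^ -2ℤ (toric-f P 1̂)) (λ j → ψ (i + j))}) ⟩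
    pair (substitute-x^ -2ℤ (toric-f P 1̂)) (λ j → ψ (ℤ.+ n + j))
      ≡⟨ sum-map (λ (k , i) → k , -2ℤ * i) (toric-f P 1̂) ⟩
    pair (toric-f P 1̂) (λ i → ψ (ℤ.+ n + -2ℤ * i))
      ≡⟨ pair-toric-f≡fine rank≡ ψ ⟩
    fine n (λ S → ℤ.+ flag-f P S) ψ 0ℤ ∎
    where
    p = x^ (ℤ.+ n) ⊛ substitute-x^ -2ℤ (toric-f P 1̂)
    ψ = truncate (δ m)

-- The cd-index

-- Σ_λ ± (-1)^|S| H(S) ψ(end of λ) over all walks λ from h, where S is the set of
-- the times at which λ is positive.
positiveWalks : ∀ m → (Vec Bool m → ℤ) → (ℤ → ℤ) → ℤ → ℤ
positiveWalks zero    H ψ h = H [] * ψ h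
positiveWalks (suc m) H ψ   = step λ h →
  if positive h then - positiveWalks m (H ∘ (true ∷_)) ψ h else positiveWalks m (H ∘ (false ∷_)) ψ h

positiveWalks-cong : ∀ m {H H′} ψ → H ≗ H′ → positiveWalks m H ψ ≗ positiveWalks m H′ ψ
positiveWalks-cong zero    ψ eq h = cong (_* ψ h) (eq [])
positiveWalks-cong (suc m) {H} {H′} ψ eq = step-cong at
  where
  at : (λ h → if positive h then - positiveWalks m (H ∘ (true ∷_)) ψ h else positiveWalks m (H ∘ (false ∷_)) ψ h)
     ≗ (λ h → if positive h then - positiveWalks m (H′ ∘ (true ∷_)) ψ h else positiveWalks m (H′ ∘ (false ∷_)) ψ h)
  at h with positive h
  ... | true  = cong -_ (positiveWalks-cong m ψ (eq ∘ (true ∷_)) h)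
  ... | false = positiveWalks-cong m ψ (eq ∘ (false ∷_)) h

positiveWalks-linear : ∀ m (xs : List A) (k : A → ℤ) (H : A → Vec Bool m → ℤ) ψ →
  positiveWalks m (λ S → Sum xs (λ x → k x * H x S)) ψ ≗ (λ h → Sum xs (λ x → k x * positiveWalks m (H x) ψ h))
positiveWalks-linear zero xs k H ψ h = begin
  Sum xs (λ x → k x * H x []) * ψ h   ≡⟨ ℤ.*-comm _ (ψ h) ⟩
  ψ h * Sum xs (λ x → k x * H x [])   ≡⟨ sum-* xs (ψ h) (λ x → k x * H x []) ⟨
  Sum xs (λ x → ψ h * (k x * H x [])) ≡⟨ sum-cong xs (λ x → rotate (ψ h) (k x) (H x [])) ⟩
  Sum xs (λ x → k x * (H x [] * ψ h)) ∎
  where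
  rotate : ∀ x y z → x * (y * z) ≡ y * (z * x)
  rotate = solve-∀
positiveWalks-linear {A = A} (suc m) xs k H ψ h = begin
  positiveWalks (suc m) (λ S → Sum xs (λ x → k x * H x S)) ψ h
    ≡⟨ step-cong at h ⟩
  step (λ h → Sum xs (λ x → k x * W x h)) h
    ≡⟨ step-sum xs (λ x h → k x * W x h) h ⟩
  Sum xs (λ x → k x * W x (ℤ.pred h) - k x * W x (ℤ.suc h))
    ≡⟨ sum-cong xs (λ x → sym (distrib (k x) (W x (ℤ.pred h)) (W x (ℤ.suc h)))) ⟩
  Sum xs (λ x → k x * positiveWalks (suc m) (H x) ψ h) ∎
  where
  W : A → ℤ → ℤ
  W x h = if positive h then - positiveWalks m (H x ∘ (true ∷_)) ψ h else positiveWalks m (H x ∘ (false ∷_)) ψ h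

  distrib : ∀ k x y → k * (x - y) ≡ k * x - k * y
  distrib = solve-∀

  at : (λ h → if positive h then - positiveWalks m (λ S → Sum xs (λ x → k x * H x (true ∷ S))) ψ h
                            else positiveWalks m (λ S → Sum xs (λ x → k x * H x (false ∷ S))) ψ h)
     ≗ (λ h → Sum xs (λ x → k x * W x h))
  at h with positive h
  ... | false = positiveWalks-linear m xs k (λ x → H x ∘ (false ∷_)) ψ h
  ... | true  = trans (cong -_ (positiveWalks-linear m xs k (λ x → H x ∘ (true ∷_)) ψ h))
    (trans (sym (sum-neg xs (λ x → k x * positiveWalks m (H x ∘ (true ∷_)) ψ h)))
      (sum-cong xs λ x → ℤ.neg-distribʳ-* (k x) _))

positiveWalks-0 : ∀ m ψ → positiveWalks m (λ _ → 0ℤ) ψ ≗ λ _ → 0ℤ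
positiveWalks-0 m ψ = positiveWalks-linear {A = Bool} m [] (λ _ → 0ℤ) (λ _ _ → 0ℤ) ψ

positiveWalks-minus : ∀ m (H H′ : Vec Bool m → ℤ) ψ →
  positiveWalks m (λ S → H S - H′ S) ψ ≗ (λ h → positiveWalks m H ψ h - positiveWalks m H′ ψ h)
positiveWalks-minus m H H′ ψ h = begin
  positiveWalks m (λ S → H S - H′ S) ψ h
    -- A difference is a linear combination over a two-element index list, which reduces it to
    -- `positiveWalks-linear`.
    ≡⟨ positiveWalks-cong m ψ (λ S → two-terms (H S) (H′ S)) h ⟩
  positiveWalks m (λ S → Sum (true ∷ false ∷ []) (λ t → sign t * (if t then H S else H′ S))) ψ h
    ≡⟨ positiveWalks-linear m (true ∷ false ∷ []) sign (λ t S → if t then H S else H′ S) ψ h ⟩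
  1ℤ * positiveWalks m H ψ h + (-1ℤ * positiveWalks m H′ ψ h + 0ℤ)
    ≡⟨ two-terms (positiveWalks m H ψ h) (positiveWalks m H′ ψ h) ⟨
  positiveWalks m H ψ h - positiveWalks m H′ ψ h ∎
  where
  sign : Bool → ℤ
  sign t = if t then 1ℤ else -1ℤ
  two-terms : ∀ x y → x - y ≡ 1ℤ * x + (-1ℤ * y + 0ℤ)
  two-terms = solve-∀

-- Inclusion and exclusion one rank at a time, the form of the passage from f_S to h_S that fits the
-- recursion of the walks.
möbius : ∀ {m} → (Vec Bool m → ℤ) → Vec Bool m → ℤ
möbius f []          = f []
möbius f (false ∷ S) = möbius (f ∘ (false ∷_)) S
möbius f (true  ∷ S) = möbius (f ∘ (true ∷_)) S - möbius (f ∘ (false ∷_)) S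

-- A walk with set S of positive times is counted for every T ⊆ S, and the sum of (-1)^|T| f_T over
-- these T is (-1)^|S| h_S. Locally, a positive time leaves both choices open and produces minus a
-- difference; any other time leaves one.
fine≡positiveWalks : ∀ m f ψ → fine m f ψ ≗ positiveWalks m (möbius f) ψ
fine≡positiveWalks zero    f ψ h = refl
fine≡positiveWalks (suc m) f ψ   = step-cong at
  where
  negate : ∀ x y → x - y ≡ - (y - x)
  negate = solve-∀
  at : (λ h → fine m (f ∘ (false ∷_)) ψ h - pos (fine m (f ∘ (true ∷_)) ψ) h)
     ≗ (λ h → if positive h then - positiveWalks m (möbius f ∘ (true ∷_)) ψ h
                            else positiveWalks m (möbius f ∘ (false ∷_)) ψ h)
  at h with positive h
  ... | false = trans (ℤ.+-identityʳ _) (fine≡positiveWalks m (f ∘ (false ∷_)) ψ h)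
  ... | true  = trans (negate (fine m (f ∘ (false ∷_)) ψ h) (fine m (f ∘ (true ∷_)) ψ h)) (cong -_
    (trans (cong₂ _-_ (fine≡positiveWalks m (f ∘ (true ∷_)) ψ h) (fine≡positiveWalks m (f ∘ (false ∷_)) ψ h))
      (sym (positiveWalks-minus m (möbius (f ∘ (true ∷_))) (möbius (f ∘ (false ∷_))) ψ h))))

sum-subsets≡möbius : ∀ {m} (f : Subset m → ℤ) S →
  Sum (subsets m) (λ T → when (does (T ⊆? S)) (-1ℤ ℤ.^ (∣ S ∣ ℕ.∸ ∣ T ∣) * f T)) ≡ möbius f S
sum-subsets≡möbius f [] = trans (ℤ.+-identityʳ _) (ℤ.*-identityˡ _)
sum-subsets≡möbius {suc m} f (false ∷ S) =
  trans (sum-vectors true false m) (trans (cong₂ _+_ (sum-0 (subsets m)) (sum-subsets≡möbius (f ∘ (false ∷_)) S))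
    (ℤ.+-identityˡ _))
sum-subsets≡möbius {suc m} f (true ∷ S) =
  trans (sum-vectors true false m) (cong₂ _+_ (sum-subsets≡möbius (f ∘ (true ∷_)) S)
    (trans (sum-cong (subsets m) flip-sign)
      (trans (sum-neg (subsets m) _) (cong -_ (sum-subsets≡möbius (f ∘ (false ∷_)) S)))))
  where
  flip-sign : ∀ T → when (does (T ⊆? S)) (-1ℤ ℤ.^ (suc ∣ S ∣ ℕ.∸ ∣ T ∣) * f (false ∷ T))
                  ≡ - when (does (T ⊆? S)) (-1ℤ ℤ.^ (∣ S ∣ ℕ.∸ ∣ T ∣) * f (false ∷ T))
  flip-sign T with T ⊆? S
  ... | no  _   = refl
  -- The inclusion makes the truncated subtraction in the exponent a true one, so that one more
  -- element of S changes the sign.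
  ... | yes T⊆S = trans (cong (λ e → -1ℤ ℤ.^ e * f (false ∷ T)) (ℕ.+-∸-assoc 1 (p⊆q⇒∣p∣≤∣q∣ T⊆S)))
    (pull (-1ℤ ℤ.^ (∣ S ∣ ℕ.∸ ∣ T ∣)) (f (false ∷ T)))
    where
    pull : ∀ x y → -1ℤ * x * y ≡ - (x * y)
    pull = solve-∀

flag-h≡möbius : ∀ P {n} (S : Subset n) → flag-h P S ≡ möbius (λ T → ℤ.+ flag-f P T) S
flag-h≡möbius P {n} S = trans (sumℤ≡Sum (List.filter (_⊆? S) (subsets n)) _)
  (trans (sum-filter (_⊆? S) (subsets n)) (sum-subsets≡möbius (λ T → ℤ.+ flag-f P T) S))

-- Expansion of cd-words in the letters a and b

module ab = Pairing (++-monoid AB) (≡-dec _≟ab_)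
module cd = Pairing (++-monoid CD) (≡-dec _≟cd_)

pair-0 : ∀ (p : ℤ⟨ab⟩.Elem) → ab.pair p (λ _ → 0ℤ) ≡ 0ℤ
pair-0 p = ab.pair-sumʳ {A = Bool} p [] (λ _ _ → 0ℤ)

two-terms : ∀ x y → 1ℤ * x + (1ℤ * y + 0ℤ) ≡ x + y
two-terms = solve-∀

coeff-letter-c : ∀ u p → ℤ⟨ab⟩.coeff u (letter-ab c ℤ⟨ab⟩.⊛ p)
  ≡ ab.pair p (λ v → ab.δ u (a ∷ v)) + ab.pair p (λ v → ab.δ u (b ∷ v))
coeff-letter-c u p = trans (ab.coeff-pair u (letter-ab c ℤ⟨ab⟩.⊛ p)) (trans (ab.pair-⊛ (letter-ab c) p {ab.δ u})
  (two-terms (ab.pair p (λ v → ab.δ u (a ∷ v))) (ab.pair p (λ v → ab.δ u (b ∷ v)))))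

coeff-letter-d : ∀ u p → ℤ⟨ab⟩.coeff u (letter-ab d ℤ⟨ab⟩.⊛ p)
  ≡ ab.pair p (λ v → ab.δ u (a ∷ b ∷ v)) + ab.pair p (λ v → ab.δ u (b ∷ a ∷ v))
coeff-letter-d u p = trans (ab.coeff-pair u (letter-ab d ℤ⟨ab⟩.⊛ p)) (trans (ab.pair-⊛ (letter-ab d) p {ab.δ u})
  (two-terms (ab.pair p (λ v → ab.δ u (a ∷ b ∷ v))) (ab.pair p (λ v → ab.δ u (b ∷ a ∷ v)))))

coeff-c : ∀ x u p → ℤ⟨ab⟩.coeff (x ∷ u) (letter-ab c ℤ⟨ab⟩.⊛ p) ≡ ℤ⟨ab⟩.coeff u p
coeff-c x u p = trans (coeff-letter-c (x ∷ u) p) (trans (at x) (sym (ab.coeff-pair u p)))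
  where
  at : ∀ x → ab.pair p (λ v → ab.δ (x ∷ u) (a ∷ v)) + ab.pair p (λ v → ab.δ (x ∷ u) (b ∷ v)) ≡ ab.pair p (ab.δ u)
  at a = trans (cong (ab.pair p (ab.δ u) +_) (pair-0 p)) (ℤ.+-identityʳ _)
  at b = trans (cong (_+ ab.pair p (ab.δ u)) (pair-0 p)) (ℤ.+-identityˡ _)

distinct : AB → AB → Bool
distinct a b = true
distinct b a = true
distinct _ _ = false

coeff-d : ∀ x y u p → ℤ⟨ab⟩.coeff (x ∷ y ∷ u) (letter-ab d ℤ⟨ab⟩.⊛ p) ≡ when (distinct x y) (ℤ⟨ab⟩.coeff u p)
coeff-d x y u p = trans (coeff-letter-d (x ∷ y ∷ u) p)
  (trans (at x y) (cong (when (distinct x y)) (sym (ab.coeff-pair u p))))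
  where
  at : ∀ x y → ab.pair p (λ v → ab.δ (x ∷ y ∷ u) (a ∷ b ∷ v)) + ab.pair p (λ v → ab.δ (x ∷ y ∷ u) (b ∷ a ∷ v))
             ≡ when (distinct x y) (ab.pair p (ab.δ u))
  at a a = cong₂ _+_ (pair-0 p) (pair-0 p)
  at a b = trans (cong (ab.pair p (ab.δ u) +_) (pair-0 p)) (ℤ.+-identityʳ _)
  at b a = trans (cong (_+ ab.pair p (ab.δ u)) (pair-0 p)) (ℤ.+-identityˡ _)
  at b b = cong₂ _+_ (pair-0 p) (pair-0 p)

expand : List CD → ℤ⟨ab⟩.Elem
expand w = ℤ⟨ab⟩.product (map letter-ab w)

degree : List CD → ℕ
degree []      = 0
degree (c ∷ w) = suc (degree w)
degree (d ∷ w) = suc (suc (degree w))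

-- Φ is an arbitrary formal sum and may list words of other degrees; this discards their
-- contribution to h_S.
coeff-expand-degree : ∀ w u → length u ≢ degree w → ℤ⟨ab⟩.coeff u (expand w) ≡ 0ℤ
coeff-expand-degree []      []          ne = contradiction refl ne
coeff-expand-degree []      (_ ∷ _)     ne = refl
coeff-expand-degree (c ∷ w) []          ne =
  trans (coeff-letter-c [] (expand w)) (cong₂ _+_ (pair-0 (expand w)) (pair-0 (expand w)))
coeff-expand-degree (c ∷ w) (x ∷ u)     ne =
  trans (coeff-c x u (expand w)) (coeff-expand-degree w u (ne ∘ cong suc))
coeff-expand-degree (d ∷ w) []          ne =
  trans (coeff-letter-d [] (expand w)) (cong₂ _+_ (pair-0 (expand w)) (pair-0 (expand w)))
coeff-expand-degree (d ∷ w) (x ∷ [])    ne =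
  trans (coeff-letter-d (x ∷ []) (expand w)) (at x)
  where
  at : ∀ x → ab.pair (expand w) (λ v → ab.δ (x ∷ []) (a ∷ b ∷ v)) + ab.pair (expand w) (λ v → ab.δ (x ∷ []) (b ∷ a ∷ v)) ≡ 0ℤ
  at a = cong₂ _+_ (pair-0 (expand w)) (pair-0 (expand w))
  at b = cong₂ _+_ (pair-0 (expand w)) (pair-0 (expand w))
coeff-expand-degree (d ∷ w) (x ∷ y ∷ u) ne =
  trans (coeff-d x y u (expand w)) (trans (cong (when (distinct x y)) (coeff-expand-degree w u (ne ∘ cong (2 ℕ.+_))))
    (when-0 (distinct x y)))

length-subsetWord : ∀ {n} (S : Subset n) → length (subsetWord S) ≡ n
length-subsetWord []      = refl
length-subsetWord (_ ∷ S) = cong suc (length-subsetWord S)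

subsetWord-injective : ∀ {n} (S T : Subset n) → subsetWord S ≡ subsetWord T → S ≡ T
subsetWord-injective []          []          _  = refl
subsetWord-injective (true  ∷ S) (true  ∷ T) eq = cong (true ∷_) (subsetWord-injective S T (∷-injectiveʳ eq))
subsetWord-injective (false ∷ S) (false ∷ T) eq = cong (false ∷_) (subsetWord-injective S T (∷-injectiveʳ eq))

coeff-abIndex : ∀ P {n} (S : Subset n) → ℤ⟨ab⟩.coeff (subsetWord S) (abIndex P n) ≡ flag-h P S
coeff-abIndex P {n} S = begin
  ℤ⟨ab⟩.coeff (subsetWord S) (abIndex P n)
    ≡⟨ ab.coeff-sum (subsetWord S) (subsets n) (λ T → flag-h P T ℤ⟨ab⟩.· ℤ⟨ab⟩.monomial (subsetWord T)) ⟩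
  Sum (subsets n) (λ T → ℤ⟨ab⟩.coeff (subsetWord S) (flag-h P T ℤ⟨ab⟩.· ℤ⟨ab⟩.monomial (subsetWord T)))
    ≡⟨ sum-cong (subsets n) term ⟩
  Sum (subsets n) (λ T → flag-h P T * ab.δ (subsetWord S) (subsetWord T))
    ≡⟨ sum-single (unique-subsets n) (∈-subsets S) (λ T T≢S → trans
         (cong (flag-h P T *_) (when-no (≡-dec _≟ab_ (subsetWord T) (subsetWord S)) (T≢S ∘ subsetWord-injective T S)))
         (ℤ.*-zeroʳ (flag-h P T))) ⟩
  flag-h P S * ab.δ (subsetWord S) (subsetWord S)
    ≡⟨ trans (cong (flag-h P S *_) (when-yes (≡-dec _≟ab_ (subsetWord S) (subsetWord S)) refl)) (ℤ.*-identityʳ _) ⟩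
  flag-h P S ∎
  where
  term : ∀ T → ℤ⟨ab⟩.coeff (subsetWord S) (flag-h P T ℤ⟨ab⟩.· ℤ⟨ab⟩.monomial (subsetWord T))
             ≡ flag-h P T * ab.δ (subsetWord S) (subsetWord T)
  term T = trans (ab.coeff-· (subsetWord S) (flag-h P T) (ℤ⟨ab⟩.monomial (subsetWord T)))
    (cong (flag-h P T *_) (ℤ.+-identityʳ _))

coeff-evaluate-cd : ∀ u Φ → ℤ⟨ab⟩.coeff u (evaluate-cd Φ) ≡ Sum Φ (λ (k , w) → k * ℤ⟨ab⟩.coeff u (expand w))
coeff-evaluate-cd u Φ = trans (ab.coeff-sum u Φ (λ (k , w) → k ℤ⟨ab⟩.· expand w))
  (sum-cong Φ λ (k , w) → ab.coeff-· u k (expand w))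

-- Folding walks at height 0

-- Σ_λ weight(λ) ψ(end of λ) over the walks λ from h that are admissible for w
admissibleWalks : List CD → (ℕ → ℤ) → ℕ → ℤ
admissibleWalks []      ψ h                   = ψ h
admissibleWalks (c ∷ w) ψ zero                = admissibleWalks w ψ 1
admissibleWalks (c ∷ w) ψ (suc zero)          = admissibleWalks w ψ 2
admissibleWalks (c ∷ w) ψ (suc (suc h))       = admissibleWalks w ψ (suc (suc (suc h))) - admissibleWalks w ψ (suc h)
admissibleWalks (d ∷ w) ψ zero                = admissibleWalks w ψ 0
admissibleWalks (d ∷ w) ψ (suc zero)          = 0ℤ
admissibleWalks (d ∷ w) ψ (suc (suc zero))    = - admissibleWalks w ψ 0
admissibleWalks (d ∷ w) ψ (suc (suc (suc h))) = 0ℤ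

-- By `coeff-c` and `coeff-d` this is an indicator: for w of degree m it is 1 if each letter d
-- covers one position in S and one outside, and 0 otherwise.
compatible : ∀ {m} → List CD → Vec Bool m → ℤ
compatible w S = ℤ⟨ab⟩.coeff (subsetWord S) (expand w)

compatibleWalks : List CD → (ℤ → ℤ) → ℤ → ℤ
compatibleWalks w ψ = positiveWalks (degree w) (compatible w) ψ

flip-positive : (ℤ → ℤ) → ℤ → ℤ
flip-positive φ h = if positive h then - φ h else φ h

compatibleWalks-c : ∀ w ψ → compatibleWalks (c ∷ w) ψ ≗ step (flip-positive (compatibleWalks w ψ))
compatibleWalks-c w ψ = step-cong at
  where
  compatible-c : ∀ t (S : Vec Bool (degree w)) → compatible (c ∷ w) (t ∷ S) ≡ compatible w S
  compatible-c t S = coeff-c (if t then b else a) (subsetWord S) (expand w)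
  at : (λ h → if positive h then - positiveWalks (degree w) (compatible (c ∷ w) ∘ (true ∷_)) ψ h
                            else positiveWalks (degree w) (compatible (c ∷ w) ∘ (false ∷_)) ψ h)
     ≗ flip-positive (compatibleWalks w ψ)
  at h with positive h
  ... | true  = cong -_ (positiveWalks-cong (degree w) ψ (compatible-c true) h)
  ... | false = positiveWalks-cong (degree w) ψ (compatible-c false) h

-- Exactly one of the two heights that a letter d passes is positive, so these
-- are the heights 0 and 1, in either order.
through-d : (ℤ → ℤ) → ℤ → ℤ
through-d φ (ℤ.+ 0) = φ 1ℤ
through-d φ (ℤ.+ 1) = - φ 0ℤ
through-d φ _       = 0ℤ

compatibleWalks-d : ∀ w ψ → compatibleWalks (d ∷ w) ψ ≗ step (through-d (compatibleWalks w ψ))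
compatibleWalks-d w ψ = step-cong at
  where
  T = compatibleWalks w ψ

  compatible-d : ∀ s t (S : Vec Bool (degree w)) → compatible (d ∷ w) (s ∷ t ∷ S)
                 ≡ when (distinct (if s then b else a) (if t then b else a)) (compatible w S)
  compatible-d s t S = coeff-d (if s then b else a) (if t then b else a) (subsetWord S) (expand w)

  after-positive : positiveWalks (suc (degree w)) (compatible (d ∷ w) ∘ (true ∷_)) ψ
                   ≗ step (λ h → if positive h then 0ℤ else T h)
  after-positive = step-cong at′
    where
    at′ : (λ h → if positive h then - positiveWalks (degree w) (compatible (d ∷ w) ∘ (true ∷_) ∘ (true ∷_)) ψ h
                               else positiveWalks (degree w) (compatible (d ∷ w) ∘ (true ∷_) ∘ (false ∷_)) ψ h)
        ≗ (λ h → if positive h then 0ℤ else T h)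
    at′ h with positive h
    ... | true  = cong -_ (trans (positiveWalks-cong (degree w) ψ (compatible-d true true) h)
                    (positiveWalks-0 (degree w) ψ h))
    ... | false = positiveWalks-cong (degree w) ψ (compatible-d true false) h

  after-nonpositive : positiveWalks (suc (degree w)) (compatible (d ∷ w) ∘ (false ∷_)) ψ
                      ≗ step (λ h → if positive h then - T h else 0ℤ)
  after-nonpositive = step-cong at′
    where
    at′ : (λ h → if positive h then - positiveWalks (degree w) (compatible (d ∷ w) ∘ (false ∷_) ∘ (true ∷_)) ψ h
                               else positiveWalks (degree w) (compatible (d ∷ w) ∘ (false ∷_) ∘ (false ∷_)) ψ h)
        ≗ (λ h → if positive h then - T h else 0ℤ)
    at′ h with positive h
    ... | true  = cong -_ (positiveWalks-cong (degree w) ψ (compatible-d false true) h)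
    ... | false = trans (positiveWalks-cong (degree w) ψ (compatible-d false false) h)
                    (positiveWalks-0 (degree w) ψ h)

  at : (λ h → if positive h then - positiveWalks (suc (degree w)) (compatible (d ∷ w) ∘ (true ∷_)) ψ h
                            else positiveWalks (suc (degree w)) (compatible (d ∷ w) ∘ (false ∷_)) ψ h)
     ≗ through-d T
  -- From 0 the sign of the step up and the sign of the positive time at height 1 cancel. From 1 the
  -- step down carries no sign, and that of the positive time at height 1 remains.
  at (ℤ.+ 0)             = trans (after-nonpositive (ℤ.+ 0)) (double-negation (T 1ℤ))
    where
    double-negation : ∀ x → 0ℤ - (- x) ≡ x
    double-negation = solve-∀
  at (ℤ.+ 1)             = trans (cong -_ (after-positive (ℤ.+ 1))) (cong -_ (ℤ.+-identityʳ (T 0ℤ)))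
  at (ℤ.+ suc (suc h))   = cong -_ (after-positive (ℤ.+ suc (suc h)))
  at -[1+ zero ]         = after-nonpositive -[1+ 0 ]
  at -[1+ suc h ]        = after-nonpositive -[1+ suc h ]

-- Reflection in height 0 reverses the sign of a step that avoids 0, so in the sum
-- over the starts ±h the walks that reach 0 within a letter c cancel and the others
-- can be folded up to nonnegative heights.
module _ (ψ : ℤ → ℤ) (vanishes : ∀ h → ψ -[1+ h ] ≡ 0ℤ) where

  compatibleWalks-at-0 : ∀ w → compatibleWalks w ψ 0ℤ ≡ admissibleWalks w (ψ ∘ ℤ.+_) 0
  compatibleWalks-symmetrized : ∀ w h →
    compatibleWalks w ψ (ℤ.+ suc h) + compatibleWalks w ψ -[1+ h ] ≡ admissibleWalks w (ψ ∘ ℤ.+_) (suc h)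

  compatibleWalks-at-0 [] = ℤ.*-identityˡ (ψ 0ℤ)
  compatibleWalks-at-0 (c ∷ w) = trans (compatibleWalks-c w ψ 0ℤ)
    (trans (reorder (T -[1+ 0 ]) (T 1ℤ)) (compatibleWalks-symmetrized w 0))
    where
    T = compatibleWalks w ψ
    reorder : ∀ x y → x - (- y) ≡ y + x
    reorder = solve-∀
  compatibleWalks-at-0 (d ∷ w) = trans (compatibleWalks-d w ψ 0ℤ)
    (trans (double-negation (compatibleWalks w ψ 0ℤ)) (compatibleWalks-at-0 w))
    where
    double-negation : ∀ x → 0ℤ - (- x) ≡ x
    double-negation = solve-∀

  compatibleWalks-symmetrized [] h =
    trans (cong₂ _+_ (ℤ.*-identityˡ (ψ (ℤ.+ suc h))) (trans (ℤ.*-identityˡ (ψ -[1+ h ])) (vanishes h)))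
      (ℤ.+-identityʳ _)
  compatibleWalks-symmetrized (c ∷ w) zero =
    trans (cong₂ _+_ (compatibleWalks-c w ψ 1ℤ) (compatibleWalks-c w ψ -1ℤ))
      (trans (cancel (T 0ℤ) (T (ℤ.+ 2)) (T -[1+ 1 ])) (compatibleWalks-symmetrized w 1))
    where
    T = compatibleWalks w ψ
    cancel : ∀ x y z → x - (- y) + (z - x) ≡ y + z
    cancel = solve-∀
  compatibleWalks-symmetrized (c ∷ w) (suc h) =
    trans (cong₂ _+_ (compatibleWalks-c w ψ (ℤ.+ suc (suc h))) (compatibleWalks-c w ψ -[1+ suc h ]))
      (trans (reorder (T (ℤ.+ suc h)) (T (ℤ.+ suc (suc (suc h)))) (T -[1+ suc (suc h) ]) (T -[1+ h ]))
        (cong₂ _-_ (compatibleWalks-symmetrized w (suc (suc h))) (compatibleWalks-symmetrized w h)))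
    where
    T = compatibleWalks w ψ
    reorder : ∀ x y z u → - x - (- y) + (z - u) ≡ y + z - (x + u)
    reorder = solve-∀
  compatibleWalks-symmetrized (d ∷ w) zero =
    -- From 1 and from -1 alike, the letter d passes 0 and ends at 1; the first steps have opposite
    -- signs.
    trans (cong₂ _+_ (compatibleWalks-d w ψ 1ℤ) (compatibleWalks-d w ψ -1ℤ)) (cancel (compatibleWalks w ψ 1ℤ))
    where
    cancel : ∀ x → x - 0ℤ + (0ℤ - x) ≡ 0ℤ
    cancel = solve-∀
  compatibleWalks-symmetrized (d ∷ w) (suc zero) =
    -- The condition on a letter d is not symmetric under reflection: from 2 it is met by passing 1
    -- and ending at 0, whereas from -2 no positive height is within reach.
    trans (cong₂ _+_ (compatibleWalks-d w ψ (ℤ.+ 2)) (compatibleWalks-d w ψ -[1+ 1 ]))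
      (trans (simplify (compatibleWalks w ψ 0ℤ)) (cong -_ (compatibleWalks-at-0 w)))
    where
    simplify : ∀ x → - x - 0ℤ + 0ℤ ≡ - x
    simplify = solve-∀
  compatibleWalks-symmetrized (d ∷ w) (suc (suc h)) =
    cong₂ _+_ (compatibleWalks-d w ψ (ℤ.+ suc (suc (suc h)))) (compatibleWalks-d w ψ -[1+ suc (suc h) ])

-- Admissible sign sequences

private variable
  n : ℕ
  w : List CD
  h : ℤ
  i : ℕ
  s t : Sign
  λs : Vec Sign n

infixr 5 _▸_
_▸_ : Sign → ℤ → ℤ
s ▸ h = signValue s + h

-- The sign sequences attached to w, when started at height h: the height is 0
-- exactly at the second position of each letter d, and positive elsewhere.
data Good : List CD → ∀ {n} → Vec Sign n → ℤ → Set where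
  []  : Good [] [] h
  c∷_ : positive (s ▸ h) ≡ true × Good w λs (s ▸ h) → Good (c ∷ w) (s ∷ λs) h
  d∷_ : positive (s ▸ h) ≡ true × t ▸ s ▸ h ≡ 0ℤ × Good w λs (t ▸ s ▸ h) → Good (d ∷ w) (s ∷ t ∷ λs) h

-- Positions are counted from 0.
data ZeroAt : ℤ → ∀ {n} → Vec Sign n → ℕ → Set where
  here  : s ▸ h ≡ 0ℤ → ZeroAt h (s ∷ λs) 0
  there : ZeroAt (s ▸ h) λs i → ZeroAt h (s ∷ λs) (suc i)

data CoveredAt : List CD → ℕ → Set where
  first  : CoveredAt (d ∷ w) 0
  second : CoveredAt (d ∷ w) 1
  c-there : CoveredAt w i → CoveredAt (c ∷ w) (suc i)
  d-there : CoveredAt w i → CoveredAt (d ∷ w) (suc (suc i))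

data NeverNegative : ℤ → ∀ {n} → Vec Sign n → Set where
  []  : NeverNegative h []
  _∷_ : 0ℤ ℤ.≤ s ▸ h → NeverNegative (s ▸ h) λs → NeverNegative h (s ∷ λs)

-- The pointwise form of `Admissible`, for an arbitrary starting height so that letters can be
-- removed one by one. A zero at i means membership in R, a zero at the next position membership in
-- R - 1. The field `zero∉first` reflects that 1 ∈ R would put 0 into R - 1, a position that no
-- letter covers.
record Aligned (w : List CD) {n} (λs : Vec Sign n) (h : ℤ) : Set where
  field
    covered⇒zero : ∀ {i} → CoveredAt w i → ZeroAt h λs i ⊎ ZeroAt h λs (suc i)
    zero⇒covered : ∀ {i} → ZeroAt h λs i → CoveredAt w i
    next⇒covered : ∀ {i} → ZeroAt h λs (suc i) → CoveredAt w i
    zero∉first   : ¬ ZeroAt h λs 0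
    nonneg       : NeverNegative h λs

open Aligned

positive⇒≢0 : positive h ≡ true → h ≢ 0ℤ
positive⇒≢0 pos refl = contradiction pos λ ()

positive⇒≥0 : positive h ≡ true → 0ℤ ℤ.≤ h
positive⇒≥0 {ℤ.+ suc _} _ = ℤ.+≤+ ℕ.z≤n

≥0∧≢0⇒positive : 0ℤ ℤ.≤ h → h ≢ 0ℤ → positive h ≡ true
≥0∧≢0⇒positive {ℤ.+ zero}  _ h≢0 = contradiction refl h≢0
≥0∧≢0⇒positive {ℤ.+ suc _} _ _   = refl

▸0≢0 : ∀ s → s ▸ 0ℤ ≢ 0ℤ
▸0≢0 Sign.+ ()
▸0≢0 Sign.- ()

good⇒aligned : Good w λs h → Aligned w λs h
good⇒aligned [] = record
  { covered⇒zero = λ () ; zero⇒covered = λ () ; next⇒covered = λ () ; zero∉first = λ () ; nonneg = [] }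
good⇒aligned (c∷ (pos , good)) = record
  { covered⇒zero = λ { (c-there cov) → Sum.map there there (covered⇒zero IH cov) }
  ; zero⇒covered = λ { (here z) → contradiction z (positive⇒≢0 pos)
                     ; (there z) → c-there (zero⇒covered IH z) }
  ; next⇒covered = λ { {zero}  (there z) → contradiction z (zero∉first IH)
                     ; {suc i} (there z) → c-there (next⇒covered IH z) }
  ; zero∉first   = λ { (here z) → positive⇒≢0 pos z }
  ; nonneg       = positive⇒≥0 pos ∷ nonneg IH
  }
  where IH = good⇒aligned good
good⇒aligned (d∷ (pos , z″ , good)) = record
  { covered⇒zero = λ { first → inj₂ (there (here z″))
                     ; second → inj₁ (there (here z″))
                     ; (d-there cov) → Sum.map (λ z → there (there z)) (λ z → there (there z)) (covered⇒zero IH cov) }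
  ; zero⇒covered = λ { (here z) → contradiction z (positive⇒≢0 pos)
                     ; (there (here _)) → second
                     ; (there (there z)) → d-there (zero⇒covered IH z) }
  ; next⇒covered = λ { {zero}        _                 → first
                     ; {suc zero}    _                 → second
                     ; {suc (suc i)} (there (there z)) → d-there (next⇒covered IH z) }
  ; zero∉first   = λ { (here z) → positive⇒≢0 pos z }
  ; nonneg       = positive⇒≥0 pos ∷ ℤ.≤-reflexive (sym z″) ∷ nonneg IH
  }
  where IH = good⇒aligned good

-- No height vanishes at the first position after a letter: after a d, because
-- the height was 0 just before.  So each d has its zero at the second position.
aligned⇒good : ∀ w (λs : Vec Sign n) → degree w ≡ n → Aligned w λs h → Good w λs h
aligned⇒good []      []       _  al = []
aligned⇒good (c ∷ w) (s ∷ λs) eq al with 0≤h ∷ nn ← nonneg al =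
  c∷ (≥0∧≢0⇒positive 0≤h (zero∉first al ∘ here) , aligned⇒good w λs (ℕ.suc-injective eq) record
    { covered⇒zero = λ cov → Sum.map (λ { (there z) → z }) (λ { (there z) → z }) (covered⇒zero al (c-there cov))
    ; zero⇒covered = λ z → c-there⁻ (zero⇒covered al (there z))
    ; next⇒covered = λ z → c-there⁻ (next⇒covered al (there z))
    -- A zero right after the letter c would put the position of c into R - 1, hence under a letter
    -- d.
    ; zero∉first   = λ z → contradiction (next⇒covered al (there z)) λ ()
    ; nonneg       = nn
    })
  where
  c-there⁻ : ∀ {i} → CoveredAt (c ∷ w) (suc i) → CoveredAt w i
  c-there⁻ (c-there cov) = cov
aligned⇒good (d ∷ w) (s ∷ t ∷ λs) eq al with 0≤h ∷ _ ∷ nn ← nonneg al | covered⇒zero al first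
... | inj₁ z                = contradiction z (zero∉first al)
... | inj₂ (there (here z″)) =
  d∷ (≥0∧≢0⇒positive 0≤h (zero∉first al ∘ here) , z″ ,
    aligned⇒good w λs (ℕ.suc-injective (ℕ.suc-injective eq)) record
      { covered⇒zero = λ cov →
          Sum.map (λ { (there (there z)) → z }) (λ { (there (there z)) → z }) (covered⇒zero al (d-there cov))
      ; zero⇒covered = λ z → d-there⁻ (zero⇒covered al (there (there z)))
      ; next⇒covered = λ z → d-there⁻ (next⇒covered al (there (there z)))
      ; zero∉first   = λ { (here {s = s′} z) → ▸0≢0 s′ (trans (cong (s′ ▸_) (sym z″)) z) }
      ; nonneg       = nn
      })
  where
  d-there⁻ : ∀ {i} → CoveredAt (d ∷ w) (suc (suc i)) → CoveredAt w i
  d-there⁻ (d-there cov) = cov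
aligned⇒good []      (_ ∷ _)  ()
aligned⇒good (c ∷ w) []       ()
aligned⇒good (d ∷ w) []       ()
aligned⇒good (d ∷ w) (_ ∷ []) ()

regroup : ∀ x y h → x + y + h ≡ y + (x + h)
regroup = solve-∀

zeroAt⇒partialSum : ZeroAt h λs i → i ℕ.< Vec.length λs × partialSum λs (suc i) + h ≡ 0ℤ
zeroAt⇒partialSum {h = h} (here {s = s} z) =
  ℕ.z<s , trans (cong (_+ h) (ℤ.+-identityʳ (signValue s))) z
zeroAt⇒partialSum {h = h} {i = suc i} (there {s = s} {λs = λs} z) with i<n , eq ← zeroAt⇒partialSum z =
  ℕ.s<s i<n , trans (regroup (signValue s) (partialSum λs (suc i)) h) eq

partialSum⇒zeroAt : ∀ (λs : Vec Sign n) {i} → i ℕ.< n → partialSum λs (suc i) + h ≡ 0ℤ → ZeroAt h λs i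
partialSum⇒zeroAt {h = h} (s ∷ λs) {zero} _ eq =
  here (trans (cong (_+ h) (sym (ℤ.+-identityʳ (signValue s)))) eq)
partialSum⇒zeroAt {h = h} (s ∷ λs) {suc i} (ℕ.s<s i<n) eq =
  there (partialSum⇒zeroAt λs i<n (trans (sym (regroup (signValue s) (partialSum λs (suc i)) h)) eq))

nonneg⇒partialSum : NeverNegative h λs → ∀ {i} → i ℕ.< Vec.length λs → 0ℤ ℤ.≤ partialSum λs (suc i) + h
nonneg⇒partialSum {h = h} (_∷_ {s = s} 0≤ nn) {zero} _ =
  subst (0ℤ ℤ.≤_) (cong (_+ h) (sym (ℤ.+-identityʳ (signValue s)))) 0≤
nonneg⇒partialSum {h = h} (_∷_ {s = s} {λs = λs} 0≤ nn) {suc i} (ℕ.s<s i<n) =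
  subst (0ℤ ℤ.≤_) (sym (regroup (signValue s) (partialSum λs (suc i)) h)) (nonneg⇒partialSum nn i<n)

partialSum⇒nonneg : ∀ (λs : Vec Sign n) → (∀ {i} → i ℕ.< n → 0ℤ ℤ.≤ partialSum λs (suc i) + h) → NeverNegative h λs
partialSum⇒nonneg         []       _  = []
partialSum⇒nonneg {h = h} (s ∷ λs) nn =
  subst (0ℤ ℤ.≤_) (cong (_+ h) (ℤ.+-identityʳ (signValue s))) (nn ℕ.z<s)
  ∷ partialSum⇒nonneg λs λ {i} i<n →
      subst (0ℤ ℤ.≤_) (regroup (signValue s) (partialSum λs (suc i)) h) (nn (ℕ.s<s i<n))

∈-[1,n]⁺ : ∀ {n i} → i ℕ.< n → suc i ∈ₗ [1, n ]
∈-[1,n]⁺ i<n = ∈-map⁺ suc (∈-upTo⁺ i<n)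

∈-[1,n]⁻ : ∀ {n x} → x ∈ₗ [1, n ] → ∃ λ i → i ℕ.< n × x ≡ suc i
∈-[1,n]⁻ x∈ = let i , i∈ , eq = ∈-map⁻ suc x∈ in i , ∈-upTo⁻ i∈ , eq

module _ (λs : Vec Sign n) where

  ∈-R⁺ : ∀ {i} → ZeroAt 0ℤ λs i → suc i ∈ₗ R λs
  ∈-R⁺ z = let i<n , eq = zeroAt⇒partialSum z in
    ∈-filter⁺ (λ i → partialSum λs i ℤ.≟ 0ℤ) (∈-[1,n]⁺ i<n) (trans (sym (ℤ.+-identityʳ _)) eq)

  ∈-R⁻ : ∀ {x} → x ∈ₗ R λs → ∃ λ i → x ≡ suc i × ZeroAt 0ℤ λs i
  ∈-R⁻ x∈ with x∈[1,n] , eq ← ∈-filter⁻ (λ i → partialSum λs i ℤ.≟ 0ℤ) {xs = [1, n ]} x∈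
    with i , i<n , refl ← ∈-[1,n]⁻ x∈[1,n] =
    i , refl , partialSum⇒zeroAt λs i<n (trans (ℤ.+-identityʳ _) eq)

  ∈-R-1⁺ : ∀ {i} → ZeroAt 0ℤ λs i → i ∈ₗ R-1 λs
  ∈-R-1⁺ z = ∈-map⁺ ℕ.pred (∈-R⁺ z)

  ∈-R-1⁻ : ∀ {x} → x ∈ₗ R-1 λs → ZeroAt 0ℤ λs x
  ∈-R-1⁻ x∈ with _ , y∈ , refl ← ∈-map⁻ ℕ.pred x∈ with _ , refl , z ← ∈-R⁻ y∈ = z

∈-coveredFrom⁺ : ∀ r → CoveredAt w i → r ℕ.+ i ∈ₗ coveredFrom r w
∈-coveredFrom⁺ {w = d ∷ w} r first  = here (ℕ.+-identityʳ r)
∈-coveredFrom⁺ {w = d ∷ w} r second = there (here (ℕ.+-comm r 1))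
∈-coveredFrom⁺ {w = c ∷ w} {i = suc i} r (c-there cov) =
  subst (_∈ₗ coveredFrom (suc r) w) (sym (ℕ.+-suc r i)) (∈-coveredFrom⁺ (suc r) cov)
∈-coveredFrom⁺ {w = d ∷ w} {i = suc (suc i)} r (d-there cov) = there (there
  (subst (_∈ₗ coveredFrom (suc (suc r)) w) (sym (trans (ℕ.+-suc r (suc i)) (cong suc (ℕ.+-suc r i))))
    (∈-coveredFrom⁺ (suc (suc r)) cov)))

∈-coveredFrom⁻ : ∀ r w {x} → x ∈ₗ coveredFrom r w → ∃ λ i → x ≡ r ℕ.+ i × CoveredAt w i
∈-coveredFrom⁻ r (c ∷ w) x∈ with i , refl , cov ← ∈-coveredFrom⁻ (suc r) w x∈ =
  suc i , sym (ℕ.+-suc r i) , c-there cov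
∈-coveredFrom⁻ r (d ∷ w) (here refl)         = 0 , sym (ℕ.+-identityʳ r) , first
∈-coveredFrom⁻ r (d ∷ w) (there (here refl)) = 1 , ℕ.+-comm 1 r , second
∈-coveredFrom⁻ r (d ∷ w) (there (there x∈)) with i , refl , cov ← ∈-coveredFrom⁻ (suc (suc r)) w x∈ =
  suc (suc i) , sym (trans (ℕ.+-suc r (suc i)) (cong suc (ℕ.+-suc r i))) , d-there cov

admissible⇒aligned : ∀ w (λs : Vec Sign n) → Admissible w λs → Aligned w λs 0ℤ
admissible⇒aligned w λs ((cov⊆ , ⊆cov) , nn) = record
  { covered⇒zero = λ cov →
      Sum.map (λ x∈ → let _ , eq , z = ∈-R⁻ λs x∈ in subst (ZeroAt 0ℤ λs) (sym (ℕ.suc-injective eq)) z) (∈-R-1⁻ λs)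
        (∈-++⁻ (R λs) (All.lookup cov⊆ (∈-coveredFrom⁺ 1 cov)))
  ; zero⇒covered = λ z → covered⁻ (All.lookup ⊆cov (∈-++⁺ˡ (∈-R⁺ λs z)))
  ; next⇒covered = λ z → covered⁻ (All.lookup ⊆cov (∈-++⁺ʳ (R λs) (∈-R-1⁺ λs z)))
  ; zero∉first   = λ z → contradiction (proj₁ (proj₂ (∈-coveredFrom⁻ 1 w
                     (All.lookup ⊆cov (∈-++⁺ʳ (R λs) (∈-R-1⁺ λs z)))))) λ ()
  ; nonneg       = partialSum⇒nonneg λs λ i<n →
      subst (0ℤ ℤ.≤_) (sym (ℤ.+-identityʳ _)) (All.lookup nn (∈-[1,n]⁺ i<n))
  }
  where
  covered⁻ : ∀ {i} → suc i ∈ₗ covered w → CoveredAt w i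
  covered⁻ x∈ with _ , refl , cov ← ∈-coveredFrom⁻ 1 w x∈ = cov

aligned⇒admissible : ∀ w (λs : Vec Sign n) → Aligned w λs 0ℤ → Admissible w λs
aligned⇒admissible w λs al = (All.tabulate to , All.tabulate from) , All.tabulate nn
  where
  to : ∀ {x} → x ∈ₗ covered w → x ∈ₗ R λs List.++ R-1 λs
  to x∈ with _ , refl , cov ← ∈-coveredFrom⁻ 1 w x∈ with covered⇒zero al cov
  ... | inj₁ z = ∈-++⁺ˡ (∈-R⁺ λs z)
  ... | inj₂ z = ∈-++⁺ʳ (R λs) (∈-R-1⁺ λs z)

  from : ∀ {x} → x ∈ₗ R λs List.++ R-1 λs → x ∈ₗ covered w
  from {x} x∈ with ∈-++⁻ (R λs) x∈
  ... | inj₁ x∈R with _ , refl , z ← ∈-R⁻ λs x∈R = ∈-coveredFrom⁺ 1 (zero⇒covered al z)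
  from {zero}  x∈ | inj₂ x∈R-1 = contradiction (∈-R-1⁻ λs x∈R-1) (zero∉first al)
  from {suc x} x∈ | inj₂ x∈R-1 = ∈-coveredFrom⁺ 1 (next⇒covered al (∈-R-1⁻ λs x∈R-1))

  nn : ∀ {x} → x ∈ₗ [1, _ ] → 0ℤ ℤ.≤ partialSum λs x
  nn x∈ with _ , i<n , refl ← ∈-[1,n]⁻ x∈ = subst (0ℤ ℤ.≤_) (ℤ.+-identityʳ _) (nonneg⇒partialSum (nonneg al) i<n)

-- Weights of admissible sign sequences

signedWeight : List CD → Vec Sign n → (ℤ → ℤ) → ℤ → ℤ
signedWeight []      []           ψ h = ψ h
signedWeight (c ∷ w) (s ∷ λs)     ψ h =
  when (positive (s ▸ h)) (signValue s * signedWeight w λs ψ (s ▸ h))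
signedWeight (d ∷ w) (s ∷ t ∷ λs) ψ h =
  when (positive (s ▸ h)) (when (does (t ▸ s ▸ h ℤ.≟ 0ℤ)) (- (signValue s * signValue t) * signedWeight w λs ψ (t ▸ s ▸ h)))
signedWeight _       _            ψ h = 0ℤ

-- Because of this vanishing, the sum over the admissible sequences extends to all sign sequences,
-- where it splits letter by letter.
signedWeight-bad : ∀ w (λs : Vec Sign n) ψ → ¬ Good w λs h → signedWeight w λs ψ h ≡ 0ℤ
signedWeight-bad []      []       ψ bad = contradiction [] bad
signedWeight-bad []      (_ ∷ _)  ψ bad = refl
signedWeight-bad (c ∷ w) []       ψ bad = refl
signedWeight-bad (d ∷ w) []       ψ bad = refl
signedWeight-bad (d ∷ w) (_ ∷ []) ψ bad = refl
signedWeight-bad {h = h} (c ∷ w) (s ∷ λs) ψ bad with positive (s ▸ h) in pos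
... | false = refl
... | true  = trans (cong (signValue s *_) (signedWeight-bad w λs ψ λ good → bad (c∷ (pos , good)))) (ℤ.*-zeroʳ (signValue s))
signedWeight-bad {h = h} (d ∷ w) (s ∷ t ∷ λs) ψ bad with positive (s ▸ h) in pos
... | false = refl
... | true  with t ▸ s ▸ h ℤ.≟ 0ℤ
...   | no  _  = refl
...   | yes z″ = trans (cong (- (signValue s * signValue t) *_) (signedWeight-bad w λs ψ λ good → bad (d∷ (pos , z″ , good))))
                   (ℤ.*-zeroʳ (- (signValue s * signValue t)))

zeros : ℤ → Vec Sign n → ℕ
zeros h []       = 0
zeros h (s ∷ λs) = (if does (s ▸ h ℤ.≟ 0ℤ) then suc else id) (zeros (s ▸ h) λs)

length-zeros : ∀ h (λs : Vec Sign n) →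
  length (filter (λ i → partialSum λs i + h ℤ.≟ 0ℤ) [1, n ]) ≡ zeros h λs
length-zeros h [] = refl
length-zeros {suc n} h (s ∷ λs) = trans (cong (length ∘ filter zero?) [1,1+n]) (split first-step)
  where
  zero? : ∀ i → Dec (partialSum (s ∷ λs) i + h ≡ 0ℤ)
  zero? i = partialSum (s ∷ λs) i + h ℤ.≟ 0ℤ

  [1,1+n] : [1, suc n ] ≡ 1 ∷ map suc [1, n ]
  [1,1+n] = cong (λ xs → 1 ∷ map suc xs) (sym (map-applyUpTo id suc n))

  filter-map-suc : ∀ xs → length (filter zero? (map suc xs)) ≡ length (filter (zero? ∘ suc) xs)
  filter-map-suc []       = refl
  filter-map-suc (x ∷ xs) with does (zero? (suc x))
  ... | true  = cong suc (filter-map-suc xs)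
  ... | false = filter-map-suc xs

  rest : length (filter zero? (map suc [1, n ])) ≡ zeros (s ▸ h) λs
  rest = begin
    length (filter zero? (map suc [1, n ]))
      ≡⟨ filter-map-suc [1, n ] ⟩
    length (filter (zero? ∘ suc) [1, n ])
      ≡⟨ cong length (filter-≐ (zero? ∘ suc) (λ i → partialSum λs i + (s ▸ h) ℤ.≟ 0ℤ)
           ((λ {i} eq → trans (sym (regroup (signValue s) (partialSum λs i) h)) eq) ,
            (λ {i} eq → trans (regroup (signValue s) (partialSum λs i) h) eq)) [1, n ]) ⟩
    length (filter (λ i → partialSum λs i + (s ▸ h) ℤ.≟ 0ℤ) [1, n ])
      ≡⟨ length-zeros (s ▸ h) λs ⟩
    zeros (s ▸ h) λs ∎

  first-step : partialSum (s ∷ λs) 1 + h ≡ s ▸ h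
  first-step = cong (_+ h) (ℤ.+-identityʳ (signValue s))

  split : partialSum (s ∷ λs) 1 + h ≡ s ▸ h → length (filter zero? (1 ∷ map suc [1, n ])) ≡ zeros h (s ∷ λs)
  split eq with zero? 1 | s ▸ h ℤ.≟ 0ℤ
  ... | yes _ | yes _ = cong suc rest
  ... | no  _ | no  _ = rest
  ... | yes z | no ¬z = contradiction (trans (sym eq) z) ¬z
  ... | no ¬z | yes z = contradiction (trans eq z) ¬z

length-R : (λs : Vec Sign n) → length (R λs) ≡ zeros 0ℤ λs
length-R {n} λs = trans
  (cong length (filter-≐ (λ i → partialSum λs i ℤ.≟ 0ℤ) (λ i → partialSum λs i + 0ℤ ℤ.≟ 0ℤ)
    (trans (ℤ.+-identityʳ _) , trans (sym (ℤ.+-identityʳ _))) [1, n ]))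
  (length-zeros 0ℤ λs)

factors : Vec Sign n → Laurent
factors λs = product (map factor (Vec.toList λs))

pair-factor : ∀ s φ → pair (factor s) φ ≡ signValue s * φ (signValue s)
pair-factor Sign.+ φ = ℤ.+-identityʳ _
pair-factor Sign.- φ = ℤ.+-identityʳ _

pair-factors : ∀ s (λs : Vec Sign n) χ h →
  pair (factors (s ∷ λs)) (λ i → χ (i + h)) ≡ signValue s * pair (factors λs) (λ i → χ (i + (s ▸ h)))
pair-factors s λs χ h = begin
  pair (factors (s ∷ λs)) (λ i → χ (i + h))
    ≡⟨ pair-⊛ (factor s) (factors λs) {λ i → χ (i + h)} ⟩
  pair (factor s) (λ i → pair (factors λs) (λ j → χ (i + j + h)))
    ≡⟨ pair-factor s (λ i → pair (factors λs) (λ j → χ (i + j + h))) ⟩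
  signValue s * pair (factors λs) (λ j → χ (signValue s + j + h))
    ≡⟨ cong (signValue s *_) (pair-cong (factors λs) λ j → cong χ (regroup (signValue s) j h)) ⟩
  signValue s * pair (factors λs) (λ i → χ (i + (s ▸ h))) ∎

zeros-positive : ∀ s (λs : Vec Sign n) → positive (s ▸ h) ≡ true → zeros h (s ∷ λs) ≡ zeros (s ▸ h) λs
zeros-positive {h = h} s λs pos with s ▸ h ℤ.≟ 0ℤ
... | yes z = contradiction z (positive⇒≢0 pos)
... | no  _ = refl

zeros-zero : ∀ s (λs : Vec Sign n) → s ▸ h ≡ 0ℤ → zeros h (s ∷ λs) ≡ suc (zeros (s ▸ h) λs)
zeros-zero {h = h} s λs z with s ▸ h ℤ.≟ 0ℤ
... | yes _ = refl
... | no ¬z = contradiction z ¬z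

-- A good walk ends at a nonnegative height, where ψ and χ agree; so t(w,x) needs no truncation
-- although it is compared with a truncated polynomial. The additional sign of a letter d belongs to
-- its zero, the element of R at its second position.
signedWeight-good : ∀ (ψ χ : ℤ → ℤ) → (∀ i → ψ (ℤ.+ i) ≡ χ (ℤ.+ i)) → 0ℤ ℤ.≤ h → Good w λs h →
  signedWeight w λs ψ h ≡ -1ℤ ℤ.^ zeros h λs * pair (factors λs) (λ i → χ (i + h))
signedWeight-good {h = ℤ.+ h} ψ χ eq 0≤h [] = begin
  ψ (ℤ.+ h)                                ≡⟨ eq h ⟩
  χ (ℤ.+ h)                                ≡⟨ pair-monomial 0ℤ {λ i → χ (i + ℤ.+ h)} ⟨
  pair 1# (λ i → χ (i + ℤ.+ h))            ≡⟨ ℤ.*-identityˡ _ ⟨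
  1ℤ * pair 1# (λ i → χ (i + ℤ.+ h))       ∎
signedWeight-good {h = h} ψ χ eq 0≤h (c∷_ {s = s} {w = w} {λs = λs} (pos , good)) = begin
  when (positive (s ▸ h)) (σ * W)          ≡⟨ cong (λ t → when t (σ * W)) pos ⟩
  σ * W                                    ≡⟨ cong (σ *_) (signedWeight-good ψ χ eq (positive⇒≥0 pos) good) ⟩
  σ * (-1ℤ ℤ.^ zeros (s ▸ h) λs * F)       ≡⟨ swap σ (-1ℤ ℤ.^ zeros (s ▸ h) λs) F ⟩
  -1ℤ ℤ.^ zeros (s ▸ h) λs * (σ * F)
    ≡⟨ cong₂ (λ z p → -1ℤ ℤ.^ z * p) (zeros-positive s λs pos) (pair-factors s λs χ h) ⟨
  -1ℤ ℤ.^ zeros h (s ∷ λs) * pair (factors (s ∷ λs)) (λ i → χ (i + h)) ∎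
  where
  σ = signValue s
  W = signedWeight w λs ψ (s ▸ h)
  F = pair (factors λs) (λ i → χ (i + (s ▸ h)))
  swap : ∀ x y z → x * (y * z) ≡ y * (x * z)
  swap = solve-∀
signedWeight-good {h = h} ψ χ eq 0≤h (d∷_ {s = s} {t = t} {w = w} {λs = λs} (pos , z″ , good)) = begin
  when (positive (s ▸ h)) (when (does (t ▸ s ▸ h ℤ.≟ 0ℤ)) (- (σ * τ) * W))
    ≡⟨ trans (cong (λ p → when p (when (does (t ▸ s ▸ h ℤ.≟ 0ℤ)) (- (σ * τ) * W))) pos) (when-yes (t ▸ s ▸ h ℤ.≟ 0ℤ) z″) ⟩
  - (σ * τ) * W
    ≡⟨ cong (- (σ * τ) *_) (signedWeight-good ψ χ eq (ℤ.≤-reflexive (sym z″)) good) ⟩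
  - (σ * τ) * (-1ℤ ℤ.^ zeros (t ▸ s ▸ h) λs * F)
    ≡⟨ swap σ τ (-1ℤ ℤ.^ zeros (t ▸ s ▸ h) λs) F ⟩
  -1ℤ ℤ.^ suc (zeros (t ▸ s ▸ h) λs) * (σ * (τ * F))
    ≡⟨ cong₂ (λ z p → -1ℤ ℤ.^ z * p) (trans (zeros-positive s (t ∷ λs) pos) (zeros-zero t λs z″))
         (trans (pair-factors s (t ∷ λs) χ h) (cong (σ *_) (pair-factors t λs χ (s ▸ h)))) ⟨
  -1ℤ ℤ.^ zeros h (s ∷ t ∷ λs) * pair (factors (s ∷ t ∷ λs)) (λ i → χ (i + h)) ∎
  where
  σ = signValue s
  τ = signValue t
  W = signedWeight w λs ψ (t ▸ s ▸ h)
  F = pair (factors λs) (λ i → χ (i + (t ▸ s ▸ h)))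
  swap : ∀ x y z u → - (x * y) * (z * u) ≡ -1ℤ * z * (x * (y * u))
  swap = solve-∀

signSequences : ∀ n → List (Vec Sign n)
signSequences = vectors (Sign.+ ∷ Sign.- ∷ [])

sum-signedWeight : ∀ w ψ h →
  Sum (signSequences (degree w)) (λ λs → signedWeight w λs ψ (ℤ.+ h)) ≡ admissibleWalks w (ψ ∘ ℤ.+_) h
sum-signedWeight [] ψ h = ℤ.+-identityʳ (ψ (ℤ.+ h))
sum-signedWeight (c ∷ w) ψ h = trans (sum-vectors Sign.+ Sign.- (degree w)) (at h)
  where
  V = signSequences (degree w)
  up : ∀ h → Sum V (λ λs → 1ℤ * signedWeight w λs ψ (ℤ.+ h)) ≡ admissibleWalks w (ψ ∘ ℤ.+_) h
  up h = trans (sum-* V 1ℤ (λ λs → signedWeight w λs ψ (ℤ.+ h)))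
    (trans (ℤ.*-identityˡ _) (sum-signedWeight w ψ h))
  down : ∀ h → Sum V (λ λs → -1ℤ * signedWeight w λs ψ (ℤ.+ h)) ≡ - admissibleWalks w (ψ ∘ ℤ.+_) h
  down h = trans (sum-* V -1ℤ (λ λs → signedWeight w λs ψ (ℤ.+ h)))
    (trans (ℤ.-1*i≡-i _) (cong -_ (sum-signedWeight w ψ h)))
  at : ∀ h → Sum V (λ λs → signedWeight (c ∷ w) (Sign.+ ∷ λs) ψ (ℤ.+ h))
             + Sum V (λ λs → signedWeight (c ∷ w) (Sign.- ∷ λs) ψ (ℤ.+ h))
             ≡ admissibleWalks (c ∷ w) (ψ ∘ ℤ.+_) h
  -- From heights 0 and 1 the step down does not arrive at a positive height, so its summand is
  -- constantly 0; from height 2 on both steps are allowed.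
  at zero          = trans (cong₂ _+_ (up 1) (sum-0 V)) (ℤ.+-identityʳ _)
  at (suc zero)    = trans (cong₂ _+_ (up 2) (sum-0 V)) (ℤ.+-identityʳ _)
  at (suc (suc h)) = cong₂ _+_ (up (suc (suc (suc h)))) (down (suc h))
sum-signedWeight (d ∷ w) ψ h =
  trans (sum-vectors Sign.+ Sign.- (suc (degree w)))
    (trans (cong₂ _+_ (sum-vectors Sign.+ Sign.- (degree w)) (sum-vectors Sign.+ Sign.- (degree w))) (at h))
  where
  V = signSequences (degree w)
  part : Sign → Sign → ℕ → ℤ
  part s t h = Sum V (λ λs → signedWeight (d ∷ w) (s ∷ t ∷ λs) ψ (ℤ.+ h))
  up : Sum V (λ λs → 1ℤ * signedWeight w λs ψ 0ℤ) ≡ admissibleWalks w (ψ ∘ ℤ.+_) 0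
  up = trans (sum-* V 1ℤ (λ λs → signedWeight w λs ψ 0ℤ)) (trans (ℤ.*-identityˡ _) (sum-signedWeight w ψ 0))
  down : Sum V (λ λs → -1ℤ * signedWeight w λs ψ 0ℤ) ≡ - admissibleWalks w (ψ ∘ ℤ.+_) 0
  down = trans (sum-* V -1ℤ (λ λs → signedWeight w λs ψ 0ℤ))
    (trans (ℤ.-1*i≡-i _) (cong -_ (sum-signedWeight w ψ 0)))
  none = sum-0 V
  at : ∀ h → part Sign.+ Sign.+ h + part Sign.+ Sign.- h + (part Sign.- Sign.+ h + part Sign.- Sign.- h)
             ≡ admissibleWalks (d ∷ w) (ψ ∘ ℤ.+_) h
  at zero = trans (cong₂ _+_ (cong₂ _+_ none up) (cong₂ _+_ none none)) (trans (ℤ.+-identityʳ _) (ℤ.+-identityˡ _))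
  at (suc zero) = cong₂ _+_ (cong₂ _+_ none none) (cong₂ _+_ none none)
  at (suc (suc zero)) = trans (cong₂ _+_ (cong₂ _+_ none none) (cong₂ _+_ none down))
    (trans (ℤ.+-identityˡ _) (ℤ.+-identityˡ _))
  at (suc (suc (suc h))) = cong₂ _+_ (cong₂ _+_ none none) (cong₂ _+_ none none)

coeff-wordPolynomial : ∀ m w →
  coeff m (wordPolynomial (degree w) w) ≡ admissibleWalks w (truncate (δ m) ∘ ℤ.+_) 0
coeff-wordPolynomial m w = begin
  coeff m (wordPolynomial (degree w) w)
    ≡⟨ coeff-sum m (filter (admissible? w) (signSequences (degree w))) weight ⟩
  Sum (filter (admissible? w) (signSequences (degree w))) (λ λs → coeff m (weight λs))
    ≡⟨ sum-filter (admissible? w) (signSequences (degree w)) ⟩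
  Sum (signSequences (degree w)) (λ λs → when (does (admissible? w λs)) (coeff m (weight λs)))
    ≡⟨ sum-cong (signSequences (degree w)) (λ λs → term λs (admissible? w λs)) ⟩
  Sum (signSequences (degree w)) (λ λs → signedWeight w λs (truncate (δ m)) 0ℤ)
    ≡⟨ sum-signedWeight w (truncate (δ m)) 0 ⟩
  admissibleWalks w (truncate (δ m) ∘ ℤ.+_) 0 ∎
  where
  term : ∀ λs (adm? : Dec (Admissible w λs)) →
         when (does adm?) (coeff m (weight λs)) ≡ signedWeight w λs (truncate (δ m)) 0ℤ
  term λs (no ¬adm) = sym (signedWeight-bad w λs (truncate (δ m)) (¬adm ∘ aligned⇒admissible w λs ∘ good⇒aligned))
  term λs (yes adm) = begin
    coeff m (weight λs)
      ≡⟨ coeff-· m (-1ℤ ℤ.^ length (R λs)) (factors λs) ⟩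
    -1ℤ ℤ.^ length (R λs) * coeff m (factors λs)
      ≡⟨ cong₂ (λ z p → -1ℤ ℤ.^ z * p) (length-R λs)
           (trans (coeff-pair m (factors λs)) (pair-cong (factors λs) λ i → cong (δ m) (sym (ℤ.+-identityʳ i)))) ⟩
    -1ℤ ℤ.^ zeros 0ℤ λs * pair (factors λs) (λ i → δ m (i + 0ℤ))
      ≡⟨ signedWeight-good (truncate (δ m)) (δ m) (λ _ → refl) ℤ.≤-refl (aligned⇒good w λs refl (admissible⇒aligned w λs adm)) ⟨
    signedWeight w λs (truncate (δ m)) 0ℤ ∎

-- The cd-words of degree n and the sum over Φ

∈-cdWords : ∀ n w → degree w ≡ n → w ∈ₗ cdWords n
∈-cdWords zero          []          _  = here refl
∈-cdWords (suc zero)    (c ∷ [])    _  = here refl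
∈-cdWords (suc (suc n)) (c ∷ w)     eq = ∈-++⁺ˡ (∈-map⁺ (c ∷_) (∈-cdWords (suc n) w (ℕ.suc-injective eq)))
∈-cdWords (suc (suc n)) (d ∷ w)     eq =
  ∈-++⁺ʳ (map (c ∷_) (cdWords (suc n))) (∈-map⁺ (d ∷_) (∈-cdWords n w (ℕ.suc-injective (ℕ.suc-injective eq))))
∈-cdWords zero          (c ∷ w)     ()
∈-cdWords zero          (d ∷ w)     ()
∈-cdWords (suc zero)    (c ∷ c ∷ w) ()
∈-cdWords (suc zero)    (c ∷ d ∷ w) ()

degree-cdWords : ∀ n {w} → w ∈ₗ cdWords n → degree w ≡ n
degree-cdWords zero          (here refl) = refl
degree-cdWords (suc zero)    (here refl) = refl
degree-cdWords (suc (suc n)) w∈ with ∈-++⁻ (map (c ∷_) (cdWords (suc n))) w∈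
... | inj₁ w∈′ with _ , v∈ , refl ← ∈-map⁻ (c ∷_) w∈′ = cong suc (degree-cdWords (suc n) v∈)
... | inj₂ w∈′ with _ , v∈ , refl ← ∈-map⁻ (d ∷_) w∈′ = cong (2 ℕ.+_) (degree-cdWords n v∈)

unique-cdWords : ∀ n → Unique (cdWords n)
unique-cdWords zero          = [] ∷ []
unique-cdWords (suc zero)    = [] ∷ []
unique-cdWords (suc (suc n)) = Unique.++⁺
  (Unique.map⁺ ∷-injectiveʳ (unique-cdWords (suc n))) (Unique.map⁺ ∷-injectiveʳ (unique-cdWords n))
  λ { (w∈ , w∈′) → c≢d (∈-map⁻ (c ∷_) w∈) (∈-map⁻ (d ∷_) w∈′) }
  where
  c≢d : ∀ {w} → (∃ λ v → v ∈ₗ cdWords (suc n) × w ≡ c ∷ v) → ¬ (∃ λ v → v ∈ₗ cdWords n × w ≡ d ∷ v)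
  c≢d (_ , _ , refl) (_ , _ , ())

-- The right side is t(w,x) for w of degree n and 0 for any other w, written uniformly as a sum over
-- the words v of degree n so that it can be paired with Φ.
positiveWalks-compatible : ∀ m n w → positiveWalks n (compatible w) (truncate (δ m)) 0ℤ
  ≡ Sum (cdWords n) (λ v → coeff m (wordPolynomial n v) * cd.δ v w)
positiveWalks-compatible m n w with degree w ℕ.≟ n
... | yes refl = begin
  compatibleWalks w (truncate (δ m)) 0ℤ
    ≡⟨ compatibleWalks-at-0 (truncate (δ m)) (λ h → refl) w ⟩
  admissibleWalks w (truncate (δ m) ∘ ℤ.+_) 0
    ≡⟨ coeff-wordPolynomial m w ⟨
  coeff m (wordPolynomial (degree w) w)
    ≡⟨ trans (cong (coeff m (wordPolynomial (degree w) w) *_) (when-yes (≡-dec _≟cd_ w w) refl)) (ℤ.*-identityʳ _) ⟨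
  coeff m (wordPolynomial (degree w) w) * cd.δ w w
    ≡⟨ sum-single (unique-cdWords (degree w)) (∈-cdWords (degree w) w refl) (λ v v≢w → trans
         (cong (coeff m (wordPolynomial (degree w) v) *_) (when-no (≡-dec _≟cd_ w v) (v≢w ∘ sym)))
         (ℤ.*-zeroʳ (coeff m (wordPolynomial (degree w) v)))) ⟨
  Sum (cdWords (degree w)) (λ v → coeff m (wordPolynomial (degree w) v) * cd.δ v w) ∎
... | no  deg≢n = begin
  positiveWalks n (compatible w) (truncate (δ m)) 0ℤ
    ≡⟨ positiveWalks-cong n (truncate (δ m)) (λ S → coeff-expand-degree w (subsetWord S)
         (λ eq → deg≢n (trans (sym eq) (length-subsetWord S)))) 0ℤ ⟩
  positiveWalks n (λ _ → 0ℤ) (truncate (δ m)) 0ℤ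
    ≡⟨ positiveWalks-0 n (truncate (δ m)) 0ℤ ⟩
  0ℤ
    ≡⟨ sum-zero (cdWords n) (λ v v∈ → trans
         (cong (coeff m (wordPolynomial n v) *_) (when-no (≡-dec _≟cd_ w v) λ { refl → deg≢n (degree-cdWords n v∈) }))
         (ℤ.*-zeroʳ (coeff m (wordPolynomial n v)))) ⟨
  Sum (cdWords n) (λ v → coeff m (wordPolynomial n v) * cd.δ v w) ∎

flag-h-cdIndex : ∀ P {n} Φ → IsCDIndex P n Φ → (S : Subset n) →
                 flag-h P S ≡ Sum Φ (λ (k , w) → k * compatible w S)
flag-h-cdIndex P {n} Φ isCDIndex S = begin
  flag-h P S                                  ≡⟨ coeff-abIndex P S ⟨
  ℤ⟨ab⟩.coeff (subsetWord S) (abIndex P n)    ≡⟨ isCDIndex (subsetWord S) ⟨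
  ℤ⟨ab⟩.coeff (subsetWord S) (evaluate-cd Φ)  ≡⟨ coeff-evaluate-cd (subsetWord S) Φ ⟩
  Sum Φ (λ (k , w) → k * compatible w S)      ∎

theorem4p3 : (P : GradedPoset) → Eulerian P → (n : ℕ) → GradedPoset.rank P ≡ suc n →
    (Φ : ℤ⟨cd⟩.Elem) → IsCDIndex P n Φ →
    shortToric P n ≋ (∑[ w ∈ cdWords n ] ℤ⟨cd⟩.coeff w Φ · wordPolynomial n w)
theorem4p3 P _ n rank≡ Φ isCDIndex m = begin
  coeff m (shortToric P n)
    ≡⟨ ToricProperties.coeff-shortToric P rank≡ m ⟩
  fine n (λ S → ℤ.+ flag-f P S) ψ 0ℤ
    ≡⟨ fine≡positiveWalks n (λ S → ℤ.+ flag-f P S) ψ 0ℤ ⟩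
  positiveWalks n (möbius (λ S → ℤ.+ flag-f P S)) ψ 0ℤ
    ≡⟨ positiveWalks-cong n ψ (λ S → trans (sym (flag-h≡möbius P S)) (flag-h-cdIndex P Φ isCDIndex S)) 0ℤ ⟩
  positiveWalks n (λ S → Sum Φ (λ (k , w) → k * compatible w S)) ψ 0ℤ
    ≡⟨ positiveWalks-linear n Φ proj₁ (compatible ∘ proj₂) ψ 0ℤ ⟩
  Sum Φ (λ (k , w) → k * positiveWalks n (compatible w) ψ 0ℤ)
    ≡⟨ sum-cong Φ (λ (k , w) → cong (k *_) (positiveWalks-compatible m n w)) ⟩
  cd.pair Φ (λ w → Sum (cdWords n) (λ v → coeff m (wordPolynomial n v) * cd.δ v w))
    -- Φ may repeat words; exchanging the sums gathers all its terms at v into the coefficient of v.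
    ≡⟨ cd.pair-sumʳ Φ (cdWords n) (λ v w → coeff m (wordPolynomial n v) * cd.δ v w) ⟩
  Sum (cdWords n) (λ v → cd.pair Φ (λ w → coeff m (wordPolynomial n v) * cd.δ v w))
    ≡⟨ sum-cong (cdWords n) collect ⟩
  Sum (cdWords n) (λ v → coeff m (ℤ⟨cd⟩.coeff v Φ · wordPolynomial n v))
    ≡⟨ coeff-sum m (cdWords n) (λ v → ℤ⟨cd⟩.coeff v Φ · wordPolynomial n v) ⟨
  coeff m (∑[ w ∈ cdWords n ] ℤ⟨cd⟩.coeff w Φ · wordPolynomial n w) ∎
  where
  ψ = truncate (δ m)
  collect : ∀ v → cd.pair Φ (λ w → coeff m (wordPolynomial n v) * cd.δ v w)
                ≡ coeff m (ℤ⟨cd⟩.coeff v Φ · wordPolynomial n v)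
  collect v = begin
    cd.pair Φ (λ w → coeff m (wordPolynomial n v) * cd.δ v w)
      ≡⟨ cd.pair-* Φ (coeff m (wordPolynomial n v)) (cd.δ v) ⟩
    coeff m (wordPolynomial n v) * cd.pair Φ (cd.δ v)
      ≡⟨ trans (ℤ.*-comm _ (cd.pair Φ (cd.δ v))) (cong (_* coeff m (wordPolynomial n v)) (sym (cd.coeff-pair v Φ))) ⟩
    ℤ⟨cd⟩.coeff v Φ * coeff m (wordPolynomial n v)
      ≡⟨ coeff-· m (ℤ⟨cd⟩.coeff v Φ) (wordPolynomial n v) ⟨
    coeff m (ℤ⟨cd⟩.coeff v Φ · wordPolynomial n v) ∎
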